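{- Let $\mathcal{C}$ be a hereditary class of graphs and $b : \mathbb{N} \rightarrow \mathbb{N}$ be a poly-logarithmic function. Then the following are equivalent: (i) There exist a poly-logarithmic function $a$ and a quasi-polynomial function $f$ such that for every $n$-vertex graph $G \in \mathcal{C}$, $G$ has a $(b(n), a(n))$-container family $\mathcal{F}$ with $|\mathcal{F}| \leq f(n)$. (ii) There exists a positive integer $k$ such that $\overline{kK_k} \notin \mathcal{C}$.
   Context: Graphs are finite and simple; $\mathbb{N}$ denotes the positive integers; logarithms are base $2$. A class of graphs is hereditary if it is closed under taking induced subgraphs. A function $g:\mathbb{N}\to\mathbb{N}$ is poly-logarithmic if there exist positive integers $c,d$ such that $g(n)\leq c\log^d n$ for every $n\geq 3$, and quasi-polynomial if there exist positive integers $c,d$ such that $g(n)\leq c\, n^{\log^d n}$ for every $n$. Here $\log^d n = (\log n)^d$. For $X\subseteq V(G)$, $\alpha(X)$ is the largest size of an independent set in $G[X]$. For positive integers $a,b$, a family $\mathcal{F}$ of vertex subsets of $G$ is a $(b,a)$-container family of $G$ if $\alpha(F)\leq a$ for every $F\in\mathcal{F}$ and for every $H\subseteq V(G)$ with $\alpha(H)\leq b$ there is some $F\in\mathcal{F}$ with $H\subseteq F$. $kK_k$ is the disjoint union of $k$ pairwise anti-complete copies of the complete graph $K_k$, and $\overline{kK_k}$ is its complement (the complete $k$-partite graph with all parts of size $k$). -}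

module Defs where

open import Data.Bool.Base using (Bool; true; false; not; _∧_)
import Data.Bool.Properties as Bool
open import Data.Fin.Base using (Fin; quotient; remainder)
open import Data.Fin.Properties using (_≟_; all?)
open import Data.Fin.Subset using (Subset; _∈_; _⊆_; ∣_∣; ⊥; inside; outside)
open import Data.Fin.Subset.Properties using (_∈?_; _⊆?_; ∉⊥; ⊥⊆; ∣⊥∣≡0)
open import Data.List.Base using (List; []; _∷_; _++_; map; filter)
open import Data.List.Extrema.Nat using (max; xs≤max; argmax-sel)
import Data.List.Membership.Propositional as List
open import Data.List.Membership.Propositional.Properties
  using (∈-map⁺; ∈-map⁻; ∈-filter⁺; ∈-filter⁻; ∈-++⁺ˡ; ∈-++⁺ʳ)
import Data.List.Relation.Unary.All as All
open import Data.List.Relation.Unary.Any using (here)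
open import Data.Nat.Base using (ℕ; zero; suc; _*_; _^_; _≤_; NonZero)
open import Data.Product.Base using (Σ-syntax; ∃-syntax; _×_; _,_; proj₁; proj₂)
open import Data.Refinement.Base using (Refinement-syntax; value)
open import Data.Sum.Base using (inj₁; inj₂)
open import Data.Vec.Base using ([]; _∷_)
open import Function.Base using (id)
open import Function.Definitions using (Injective)
open import Level using (Level; 0ℓ) renaming (suc to lsuc)
open import Relation.Binary.PropositionalEquality
open import Relation.Nullary.Decidable
  using (Dec; does; yes; no; _×-dec_; _→-dec_; dec-true)
open import Relation.Nullary.Negation using (contradiction)

ℕ⁺ : Set
ℕ⁺ = [ n ∈ ℕ ∣ NonZero n ]

------------------------------------------------------------------------
-- Growth of functions on the positive integers

-- For n, q ≥ 1 this is the real inequality log n ≤ p / q (base 2),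
-- that is, n ≤ 2^(p/q).
log_≤_/_ : ℕ → ℕ → ℕ → Set
log n ≤ p / q = n ^ q ≤ 2 ^ p

-- The real inequality x ≤ c · (log n)^d.  The right-hand side is the
-- infimum of c · (p/q)^d over all rationals p/q ≥ log n ≥ 0, so the
-- inequality holds iff x ≤ c · (p/q)^d for all of those; denominators
-- are then cleared.
_≤_·log^_[_] : ℕ → ℕ → ℕ → ℕ → Set
x ≤ c ·log^ d [ n ] =
  ∀ p q → .{{NonZero q}} → log n ≤ p / q → x * q ^ d ≤ c * p ^ d

-- The real inequality x ≤ c · n^((log n)^d).  As above, it holds iff
-- x ≤ c · n^((p/q)^d) for all rationals p/q ≥ log n; both sides are then
-- raised to the power q^d.
_≤_·_^log^_ : ℕ → ℕ → ℕ → ℕ → Set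
x ≤ c · n ^log^ d =
  ∀ p q → .{{NonZero q}} → log n ≤ p / q →
  x ^ (q ^ d) ≤ c ^ (q ^ d) * n ^ (p ^ d)

PolyLogarithmic : (ℕ⁺ → ℕ⁺) → Set
PolyLogarithmic g =
  Σ[ c ∈ ℕ⁺ ] Σ[ d ∈ ℕ⁺ ] (∀ n → 3 ≤ value n →
    value (g n) ≤ value c ·log^ value d [ value n ])

QuasiPolynomial : (ℕ⁺ → ℕ⁺) → Set
QuasiPolynomial g =
  Σ[ c ∈ ℕ⁺ ] Σ[ d ∈ ℕ⁺ ] (∀ n →
    value (g n) ≤ value c · value n ^log^ value d)

------------------------------------------------------------------------
-- Graphs

record Graph (n : ℕ) : Set where
  field
    adj      : Fin n → Fin n → Bool
    symm     : ∀ u v → adj u v ≡ adj v u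
    loopless : ∀ v → adj v v ≡ false

open Graph public

-- An isomorphism of H onto an induced subgraph of G.
record InducedEmbedding {m n} (H : Graph m) (G : Graph n) : Set where
  field
    to        : Fin m → Fin n
    injective : Injective _≡_ _≡_ to
    preserves : ∀ u v → adj H u v ≡ adj G (to u) (to v)

GraphClass : (ℓ : Level) → Set (lsuc ℓ)
GraphClass ℓ = ∀ {n} → Graph n → Set ℓ

-- Since embeddings rather than subsets are used, this includes closure
-- under isomorphism, which is implicit in speaking of a class of graphs.
Hereditary : ∀ {ℓ} → GraphClass ℓ → Set ℓ
Hereditary C =
  ∀ {m n} {H : Graph m} {G : Graph n} → InducedEmbedding H G → C G → C H

private
  ≟-sym : ∀ {n} (u v : Fin n) → does (u ≟ v) ≡ does (v ≟ u)
  ≟-sym u v with u ≟ v | v ≟ u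
  ... | yes _ | yes _ = refl
  ... | no _  | no _  = refl
  ... | yes p | no q  = contradiction (sym p) q
  ... | no p  | yes q = contradiction (sym q) p

  ≟-refl : ∀ {n} (v : Fin n) → does (v ≟ v) ≡ true
  ≟-refl v = dec-true (v ≟ v) refl

complete : ∀ n → Graph n
complete n = record
  { adj      = λ u v → not (does (u ≟ v))
  ; symm     = λ u v → cong not (≟-sym u v)
  ; loopless = λ v → cong not (≟-refl v)
  }

complement : ∀ {n} → Graph n → Graph n
complement G = record
  { adj      = λ u v → not (does (u ≟ v)) ∧ not (adj G u v)
  ; symm     = λ u v → cong₂ _∧_ (cong not (≟-sym u v)) (cong not (symm G u v))
  ; loopless = λ v → cong (λ t → not t ∧ not (adj G v v)) (≟-refl v)
  }

-- The disjoint union of k copies of G; the vertex i of Fin (k * n) is the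
-- vertex remainder n i of the copy with index quotient n i.
copies : ∀ k {n} → Graph n → Graph (k * n)
copies k {n} G = record
  { adj      = λ u v → does (quotient {k} n u ≟ quotient n v)
                       ∧ adj G (remainder {k} n u) (remainder {k} n v)
  ; symm     = λ u v → cong₂ _∧_ (≟-sym (quotient {k} n u) (quotient n v))
                                 (symm G _ _)
  ; loopless = λ v → trans (cong (does (quotient {k} n v ≟ quotient n v) ∧_)
                                 (loopless G _))
                           (Bool.∧-zeroʳ _)
  }

------------------------------------------------------------------------
-- Independence number

Independent : ∀ {n} → Graph n → Subset n → Set
Independent G S = ∀ u v → u ∈ S → v ∈ S → adj G u v ≡ false

independent? : ∀ {n} (G : Graph n) (S : Subset n) → Dec (Independent G S)
independent? G S = all? λ u → all? λ v →
  (u ∈? S) →-dec ((v ∈? S) →-dec (adj G u v Bool.≟ false))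

subsets : ∀ n → List (Subset n)
subsets zero    = [] ∷ []
subsets (suc n) = map (inside ∷_) (subsets n) ++ map (outside ∷_) (subsets n)

independentSubsets : ∀ {n} → Graph n → Subset n → List (Subset n)
independentSubsets {n} G X =
  filter (λ S → (S ⊆? X) ×-dec independent? G S) (subsets n)

-- The default value 0 is harmless: the empty set is always independent.
α : ∀ {n} → Graph n → Subset n → ℕ
α G X = max 0 (map ∣_∣ (independentSubsets G X))

subsets-complete : ∀ {n} (S : Subset n) → S List.∈ subsets n
subsets-complete []            = here refl
subsets-complete (inside ∷ S)  =
  ∈-++⁺ˡ (∈-map⁺ (inside ∷_) (subsets-complete S))
subsets-complete (outside ∷ S) =
  ∈-++⁺ʳ _ (∈-map⁺ (outside ∷_) (subsets-complete S))

α-maximal : ∀ {n} (G : Graph n) {X S : Subset n} →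
            S ⊆ X → Independent G S → ∣ S ∣ ≤ α G X
α-maximal G {X} {S} S⊆X ind =
  All.lookup (xs≤max 0 (map ∣_∣ (independentSubsets G X)))
    (∈-map⁺ ∣_∣ (∈-filter⁺ _ (subsets-complete S) ((λ {x} → S⊆X {x}) , ind)))

α-attained : ∀ {n} (G : Graph n) (X : Subset n) →
             ∃[ S ] S ⊆ X × Independent G S × ∣ S ∣ ≡ α G X
α-attained {n} G X
  with argmax-sel id 0 (map ∣_∣ (independentSubsets G X))
... | inj₁ α≡0 =
  ⊥ , ⊥⊆ , (λ u v u∈⊥ → contradiction u∈⊥ ∉⊥) , trans (∣⊥∣≡0 n) (sym α≡0)
... | inj₂ α∈ with ∈-map⁻ ∣_∣ α∈
...   | S , S∈ , α≡∣S∣ = S , proj₁ p , proj₂ p , sym α≡∣S∣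
  where
  p : S ⊆ X × Independent G S
  p = proj₂ (∈-filter⁻ (λ T → (T ⊆? X) ×-dec independent? G T)
                       {xs = subsets n} S∈)

------------------------------------------------------------------------
-- Containers

-- A family is a list; since the members of a list may repeat, its length
-- bounds the number of distinct members from above.
IsContainerFamily : ∀ {n} → Graph n → ℕ⁺ → ℕ⁺ → List (Subset n) → Set
IsContainerFamily G b a 𝓕 =
  (∀ F → F List.∈ 𝓕 → α G F ≤ value a) ×
  (∀ H → α G H ≤ value b → ∃[ F ] F List.∈ 𝓕 × H ⊆ F)

{-# OPTIONS --safe #-}
module Submission where

-- (ii) ⇒ (i): by induction on r, the vertex sets X containing no r pairwise
-- complete independent k-sets have containers.  Let b = b(n), s = b k, and let
-- 𝓢 be the family of independent s-sets of X; say that S ∈ 𝓢 hits v if v has at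
-- least k neighbours in S.  The vertices hit by S lie in the union of the common
-- neighbourhoods of the k-subsets of S, which are covered by induction.  Call v
-- high if it is hit by more than a fraction 1 / (2 b) of 𝓢.  Greedily,
-- O(b log n) members of 𝓢 hit all high vertices.  If α(H) ≤ b, the low part of H
-- is dominated by a maximum independent set T of size at most b, for which there
-- are n^O(b) choices.  Every independent s-set in N(T) has k elements in N(v) for
-- some v ∈ T, so passing from X to N(T) at least halves |𝓢|, and O(s log n)
-- rounds suffice.
--
-- (i) ⇒ (ii): let k be a large power of two.  Transversals of the k parts of the
-- complement of kK_k are cliques, while a container meets each part in at most
-- a < k / 2 vertices.  Choosing one vertex per part by averaging, each choice
-- halves the number of containers still containing the transversal, so fewer
-- than 2^k containers cannot capture all transversals.

open import Defs
open import Data.Bool.Base using (true; false; if_then_else_)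
import Data.Bool.Properties as Bool
open import Data.Fin.Base as Fin using (Fin; zero; suc; quotient; remainder; combine)
import Data.Fin.Properties as Fin
open import Data.Fin.Subset as Subset using (Subset; ∣_∣; _∪_; _∩_; ⁅_⁆; inside; outside)
import Data.Fin.Subset.Properties as Subset
open import Data.Irrelevant using ([_])
open import Data.List.Base
  using (List; []; _∷_; _++_; length; map; filter; take; lookup; allFin; cartesianProductWith)
open import Data.List.Membership.Propositional using (_∈_; find; lose)
open import Data.List.Membership.Propositional.Properties
open import Data.List.Properties
  using (filter-some; map-cong; length-map; length-++; length-take; length-filter; length-tabulate)
open import Data.List.Relation.Unary.All as All using (All; []; _∷_)
import Data.List.Relation.Unary.All.Properties as All
open import Data.List.Relation.Unary.AllPairs using ([]; _∷_)
open import Data.List.Relation.Unary.Any as Any using (Any; here; there; any?)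
open import Data.List.Relation.Unary.Unique.DecPropositional using (unique?)
open import Data.List.Relation.Unary.Unique.Propositional using (Unique)
import Data.List.Relation.Unary.Unique.Propositional.Properties as Unique
open import Data.Nat.Base
open import Data.Nat.ListAction using (sum)
open import Data.Nat.Properties
open import Data.Nat.Tactic.RingSolver using (solve-∀)
open import Data.Product.Base using (Σ-syntax; ∃-syntax; _×_; _,_; proj₁; proj₂)
open import Data.Refinement.Base using (value; _,_)
open import Data.Sum.Base using (_⊎_; inj₁; inj₂)
open import Data.Unit.Base using (⊤; tt)
open import Data.Vec.Base as Vec using ([]; _∷_; here; there)
open import Data.Vec.Properties using ([]=⇒lookup; lookup⇒[]=; lookup∘tabulate)
open import Function.Base using (_∘_)
open import Function.Bundles using (_⇔_; mk⇔)
open import Function.Definitions using (Injective)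
open import Level using (0ℓ)
open import Relation.Binary.Core using (REL)
open import Relation.Binary.Definitions using () renaming (Decidable to Decidable₂)
open import Relation.Binary.PropositionalEquality
open import Relation.Nullary.Decidable
  using (Dec; does; yes; no; ¬?; map′; _×-dec_; dec-true; dec-false; decidable-stable)
open import Relation.Nullary.Negation using (¬_; contradiction)
open import Relation.Unary using (Pred; Decidable; ∅)

-- Counting along lists, double counting and averaging.

count : {A : Set} {P : Pred A 0ℓ} → Decidable P → List A → ℕ
count P? xs = length (filter P? xs)

module _ {A : Set} {P : Pred A 0ℓ} (P? : Decidable P) where

  indicator : A → ℕ
  indicator x = if does (P? x) then 1 else 0

  count-∷ : ∀ x xs → count P? (x ∷ xs) ≡ indicator x + count P? xs
  count-∷ x xs with does (P? x)
  ... | true  = refl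
  ... | false = refl

  count-complement : ∀ xs → count P? xs + count (¬? ∘ P?) xs ≡ length xs
  count-complement []       = refl
  count-complement (x ∷ xs) with P? x
  ... | yes _ = cong suc (count-complement xs)
  ... | no  _ = trans (+-suc _ _) (cong suc (count-complement xs))

  count-filter-≤ : {Q : Pred A 0ℓ} (Q? : Decidable Q) →
                   ∀ xs → count P? (filter Q? xs) ≤ count P? xs
  count-filter-≤ Q? []       = z≤n
  count-filter-≤ Q? (x ∷ xs) with does (Q? x)
  ... | false = ≤-trans (≤-trans (count-filter-≤ Q? xs) (m≤n+m _ (indicator x)))
                        (≤-reflexive (sym (count-∷ x xs)))
  ... | true  rewrite count-∷ x (filter Q? xs) | count-∷ x xs =
    +-monoʳ-≤ (indicator x) (count-filter-≤ Q? xs)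

module _ {A : Set} (f : A → ℕ) (K c : ℕ) where

  sum-≤ : ∀ xs → (∀ {x} → x ∈ xs → K * f x ≤ c) →
          K * sum (map f xs) ≤ length xs * c
  sum-≤ []       _ = ≤-reflexive (*-zeroʳ K)
  sum-≤ (x ∷ xs) h = begin
    K * (f x + sum (map f xs))     ≡⟨ *-distribˡ-+ K (f x) _ ⟩
    K * f x + K * sum (map f xs)   ≤⟨ +-mono-≤ (h (here refl)) (sum-≤ xs (h ∘ there)) ⟩
    c + length xs * c              ∎
    where open ≤-Reasoning

  sum-≥ : ∀ xs → (∀ {x} → x ∈ xs → c ≤ K * f x) →
          length xs * c ≤ K * sum (map f xs)
  sum-≥ []       _ = z≤n
  sum-≥ (x ∷ xs) h = begin
    c + length xs * c              ≤⟨ +-mono-≤ (h (here refl)) (sum-≥ xs (h ∘ there)) ⟩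
    K * f x + K * sum (map f xs)   ≡⟨ *-distribˡ-+ K (f x) _ ⟨
    K * (f x + sum (map f xs))     ∎
    where open ≤-Reasoning

module _ {A B : Set} {R : REL A B 0ℓ} (R? : Decidable₂ R) where

  private
    sum-indicator-+ : ∀ x (g : B → ℕ) ys →
      sum (map (λ y → indicator (R? x) y + g y) ys) ≡
      count (R? x) ys + sum (map g ys)
    sum-indicator-+ x g []       = refl
    sum-indicator-+ x g (y ∷ ys)
      rewrite count-∷ (R? x) y ys | sum-indicator-+ x g ys =
      interchange (indicator (R? x) y) (g y) (count (R? x) ys) _
      where
      interchange : ∀ i j k l → i + j + (k + l) ≡ i + k + (j + l)
      interchange = solve-∀

  double-counting : ∀ xs ys →
    sum (map (λ x → count (R? x) ys) xs) ≡
    sum (map (λ y → count (λ x → R? x y) xs) ys)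
  double-counting []       []       = refl
  double-counting []       (y ∷ ys) = double-counting [] ys
  double-counting (x ∷ xs) ys = begin
    count (R? x) ys + sum (map (λ x → count (R? x) ys) xs)
      ≡⟨ cong (count (R? x) ys +_) (double-counting xs ys) ⟩
    count (R? x) ys + sum (map (λ y → count (λ x → R? x y) xs) ys)
      ≡⟨ sum-indicator-+ x _ ys ⟨
    sum (map (λ y → indicator (R? x) y + count (λ x → R? x y) xs) ys)
      ≡⟨ cong sum (map-cong (λ y → sym (count-∷ (λ x → R? x y) x xs)) ys) ⟩
    sum (map (λ y → count (λ x → R? x y) (x ∷ xs)) ys) ∎
    where
    open ≡-Reasoning

  -- Related pairs are counted in two ways: if every `y` fell short of the fraction `1 / K` of `xs`,
  -- there would be too few pairs. The hypothesis is strict so that it also rules out an empty `ys`.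
  averaging : ∀ K xs ys → 0 < length xs →
    (∀ {x} → x ∈ xs → length ys < K * count (R? x) ys) →
    ∃[ y ] y ∈ ys × length xs ≤ K * count (λ x → R? x y) xs
  averaging K xs ys xs≢[] h
    with any? (λ y → length xs ≤? K * count (λ x → R? x y) xs) ys
  ... | yes p = find p
  ... | no ¬p = contradiction lt (≤⇒≯ ge)
    where
    N = K * sum (map (λ y → count (λ x → R? x y) xs) ys)
    ge : N ≤ length ys * length xs
    ge = sum-≤ _ K (length xs) ys
      (λ y∈ → <⇒≤ (≰⇒> λ le → ¬p (lose y∈ le)))
    lt : length ys * length xs < N
    lt = begin-strict
      length ys * length xs        ≡⟨ *-comm (length ys) _ ⟩
      length xs * length ys        <⟨ *-monoʳ-< (length xs) {{>-nonZero xs≢[]}} (n<1+n _) ⟩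
      length xs * suc (length ys)  ≤⟨ sum-≥ _ K _ xs h ⟩
      K * sum (map (λ x → count (R? x) ys) xs) ≡⟨ cong (K *_) (double-counting xs ys) ⟩
      N ∎
      where open ≤-Reasoning

  -- Each `y` contributes at least 1 to the number of related pairs, and each `x` at most `c / K`.
  -- This serves both the pigeonhole argument and the halving of `𝓢`.
  union-bound : ∀ K c xs ys →
    (∀ {x} → x ∈ xs → K * count (R? x) ys ≤ c) →
    (∀ {y} → y ∈ ys → Any (λ x → R x y) xs) →
    K * length ys ≤ length xs * c
  union-bound K c xs ys h cov = begin
    K * length ys ≡⟨ cong (K *_) (*-identityʳ _) ⟨
    K * (length ys * 1) ≤⟨ *-monoʳ-≤ K (≤-trans (sum-≥ _ 1 1 ys λ y∈ →
         ≤-trans (filter-some (λ x → R? x _) (cov y∈)) (≤-reflexive (sym (*-identityˡ _))))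
         (≤-reflexive (*-identityˡ _))) ⟩
    K * sum (map (λ y → count (λ x → R? x y) xs) ys) ≡⟨ cong (K *_) (double-counting xs ys) ⟨
    K * sum (map (λ x → count (R? x) ys) xs) ≤⟨ sum-≤ _ K c xs h ⟩
    length xs * c ∎
    where open ≤-Reasoning

-- Short lists, elements of subsets, and subsets cut out by decidable predicates.

length-cartesianProductWith : {A B C : Set} (f : A → B → C) → ∀ xs ys →
  length (cartesianProductWith f xs ys) ≡ length xs * length ys
length-cartesianProductWith f []       ys = refl
length-cartesianProductWith f (x ∷ xs) ys =
  trans (length-++ (map (f x) ys))
        (cong₂ _+_ (length-map (f x) ys) (length-cartesianProductWith f xs ys))

lists≤ : {A : Set} → ℕ → List A → List (List A)
lists≤ zero    xs = [] ∷ []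
lists≤ (suc k) xs = [] ∷ cartesianProductWith _∷_ xs (lists≤ k xs)

length-lists≤ : {A : Set} → ∀ k (xs : List A) →
                length (lists≤ k xs) ≤ suc (length xs) ^ k
length-lists≤ zero    xs = ≤-refl
length-lists≤ (suc k) xs = begin
  suc (length (cartesianProductWith _∷_ xs (lists≤ k xs)))
    ≡⟨ cong suc (length-cartesianProductWith _∷_ xs _) ⟩
  1 + length xs * length (lists≤ k xs)
    ≤⟨ +-mono-≤ (m^n>0 (suc (length xs)) k) (*-monoʳ-≤ (length xs) (length-lists≤ k xs)) ⟩
  suc (length xs) ^ suc k ∎
  where open ≤-Reasoning

∈-lists≤ : {A : Set} → ∀ {k} {xs ys : List A} →
           length ys ≤ k → (∀ {y} → y ∈ ys → y ∈ xs) → ys ∈ lists≤ k xs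
∈-lists≤ {k = zero}  {ys = []}    _       _   = here refl
∈-lists≤ {k = suc _} {ys = []}    _       _   = here refl
∈-lists≤ {k = suc _} {ys = _ ∷ _} (s≤s p) sub =
  there (∈-cartesianProductWith⁺ _∷_ (sub (here refl)) (∈-lists≤ p (sub ∘ there)))

length-allFin : ∀ n → length (allFin n) ≡ n
length-allFin n = length-tabulate {n = n} (λ i → i)

elements : ∀ {n} → Subset n → List (Fin n)
elements []            = []
elements (inside  ∷ p) = zero ∷ map suc (elements p)
elements (outside ∷ p) = map suc (elements p)

length-elements : ∀ {n} (p : Subset n) → length (elements p) ≡ ∣ p ∣
length-elements []            = refl
length-elements (inside  ∷ p) = cong suc (trans (length-map Fin.suc (elements p)) (length-elements p))
length-elements (outside ∷ p) = trans (length-map Fin.suc (elements p)) (length-elements p)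

∈-elements⁺ : ∀ {n} {x : Fin n} {p} → x Subset.∈ p → x ∈ elements p
∈-elements⁺ {p = inside  ∷ p} here      = here refl
∈-elements⁺ {p = inside  ∷ p} (there i) = there (∈-map⁺ suc (∈-elements⁺ i))
∈-elements⁺ {p = outside ∷ p} (there i) = ∈-map⁺ suc (∈-elements⁺ i)

∈-elements⁻ : ∀ {n} {x : Fin n} {p} → x ∈ elements p → x Subset.∈ p
∈-elements⁻ {p = inside  ∷ p} (here refl) = here
∈-elements⁻ {p = inside  ∷ p} (there i) with _ , j , refl ← ∈-map⁻ suc i =
  there (∈-elements⁻ j)
∈-elements⁻ {p = outside ∷ p} i with _ , j , refl ← ∈-map⁻ suc i =
  there (∈-elements⁻ j)

elements-unique : ∀ {n} (p : Subset n) → Unique (elements p)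
elements-unique []            = []
elements-unique (inside  ∷ p) =
  All.tabulate (λ i eq → 0∉ (subst (_∈ _) (sym eq) i)) ∷
  Unique.map⁺ Fin.suc-injective (elements-unique p)
  where
  0∉ : ¬ (zero ∈ map suc (elements p))
  0∉ i with _ , _ , () ← ∈-map⁻ suc i
elements-unique (outside ∷ p) = Unique.map⁺ Fin.suc-injective (elements-unique p)

module _ {n} {P : Pred (Fin n) 0ℓ} (P? : Decidable P) where

  ⟪_⟫ : Subset n
  ⟪_⟫ = Vec.tabulate (does ∘ P?)

  ∈⟪⟫⁺ : ∀ {x} → P x → x Subset.∈ ⟪_⟫
  ∈⟪⟫⁺ {x} px = lookup⇒[]= x _ (trans (lookup∘tabulate _ x) (dec-true (P? x) px))

  ∈⟪⟫⁻ : ∀ {x} → x Subset.∈ ⟪_⟫ → P x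
  ∈⟪⟫⁻ {x} x∈ with P? x | trans (sym (lookup∘tabulate (does ∘ P?) x)) ([]=⇒lookup x∈)
  ... | yes px | _ = px

-- Subadditivity of the independence number.

∣p∪q∣≤∣p∣+∣q∣ : ∀ {n} (p q : Subset n) → ∣ p ∪ q ∣ ≤ ∣ p ∣ + ∣ q ∣
∣p∪q∣≤∣p∣+∣q∣ []            []            = z≤n
∣p∪q∣≤∣p∣+∣q∣ (inside  ∷ p) (inside  ∷ q) =
  s≤s (≤-trans (∣p∪q∣≤∣p∣+∣q∣ p q) (+-monoʳ-≤ ∣ p ∣ (n≤1+n _)))
∣p∪q∣≤∣p∣+∣q∣ (inside  ∷ p) (outside ∷ q) = s≤s (∣p∪q∣≤∣p∣+∣q∣ p q)
∣p∪q∣≤∣p∣+∣q∣ (outside ∷ p) (inside  ∷ q) =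
  ≤-trans (s≤s (∣p∪q∣≤∣p∣+∣q∣ p q)) (≤-reflexive (sym (+-suc _ _)))
∣p∪q∣≤∣p∣+∣q∣ (outside ∷ p) (outside ∷ q) = ∣p∪q∣≤∣p∣+∣q∣ p q

module _ {n} (G : Graph n) where

  α-mono : ∀ {X Y} → X Subset.⊆ Y → α G X ≤ α G Y
  α-mono {X} X⊆Y with S , S⊆X , ind , eq ← α-attained G X =
    ≤-trans (≤-reflexive (sym eq)) (α-maximal G (X⊆Y ∘ S⊆X) ind)

  α≤∣∣ : ∀ X → α G X ≤ ∣ X ∣
  α≤∣∣ X with S , S⊆X , ind , eq ← α-attained G X =
    ≤-trans (≤-reflexive (sym eq)) (Subset.p⊆q⇒∣p∣≤∣q∣ S⊆X)

  independent-∩ : ∀ {S} X → Independent G S → Independent G (S ∩ X)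
  independent-∩ {S} X ind u v u∈ v∈ =
    ind u v (proj₁ (Subset.x∈p∩q⁻ S X u∈)) (proj₁ (Subset.x∈p∩q⁻ S X v∈))

  α-∪ : ∀ X Y → α G (X ∪ Y) ≤ α G X + α G Y
  α-∪ X Y with S , S⊆ , ind , eq ← α-attained G (X ∪ Y) = begin
    α G (X ∪ Y)             ≡⟨ eq ⟨
    ∣ S ∣                   ≤⟨ Subset.p⊆q⇒∣p∣≤∣q∣ split ⟩
    ∣ (S ∩ X) ∪ (S ∩ Y) ∣   ≤⟨ ∣p∪q∣≤∣p∣+∣q∣ (S ∩ X) (S ∩ Y) ⟩
    ∣ S ∩ X ∣ + ∣ S ∩ Y ∣
      ≤⟨ +-mono-≤ (α-maximal G (Subset.p∩q⊆q S X) (independent-∩ X ind))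
                  (α-maximal G (Subset.p∩q⊆q S Y) (independent-∩ Y ind)) ⟩
    α G X + α G Y           ∎
    where
    open ≤-Reasoning
    split : S Subset.⊆ (S ∩ X) ∪ (S ∩ Y)
    split x∈S with Subset.x∈p∪q⁻ X Y (S⊆ x∈S)
    ... | inj₁ x∈X = Subset.x∈p∪q⁺ (inj₁ (Subset.x∈p∩q⁺ (x∈S , x∈X)))
    ... | inj₂ x∈Y = Subset.x∈p∪q⁺ (inj₂ (Subset.x∈p∩q⁺ (x∈S , x∈Y)))

-- Container families relative to a region, and how they combine.

module _ {n} (G : Graph n) (b : ℕ) where

  -- Sets H with α(H) ≤ b need only be captured inside Y.  The number of
  -- containers is measured by the exponent m of a power of two.
  record HasContainers (a m : ℕ) (Y : Pred (Fin n) 0ℓ) : Set where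
    field
      family  : List (Subset n)
      few     : length family ≤ 2 ^ m
      sparse  : ∀ {F} → F ∈ family → α G F ≤ a
      capture : ∀ H → α G H ≤ b →
                ∃[ F ] F ∈ family × (∀ {x} → x Subset.∈ H → Y x → x Subset.∈ F)

module _ {n} {G : Graph n} {b : ℕ} where

  open HasContainers

  containers-mono : ∀ {a a′ m m′ Y Y′} → a ≤ a′ → m ≤ m′ → (∀ {x} → Y′ x → Y x) →
                    HasContainers G b a m Y → HasContainers G b a′ m′ Y′
  containers-mono a≤ m≤ Y′⊆Y c = record
    { family  = family c
    ; few     = ≤-trans (few c) (^-monoʳ-≤ 2 m≤)
    ; sparse  = λ F∈ → ≤-trans (sparse c F∈) a≤
    ; capture = λ H αH → let F , F∈ , sub = capture c H αH in
                         F , F∈ , λ x∈ y → sub x∈ (Y′⊆Y y)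
    }

  containers-single : ∀ X → HasContainers G b (α G X) 0 (Subset._∈ X)
  containers-single X = record
    { family  = X ∷ []
    ; few     = ≤-refl
    ; sparse  = λ { (here refl) → ≤-refl }
    ; capture = λ _ _ → X , here refl , λ _ x∈ → x∈
    }

  -- All unions of a container from each family are taken: sizes multiply, so exponents add. This is
  -- why capture is relative to `Y`: the same `H` is treated separately in the two regions.
  containers-∪ : ∀ {a a′ m m′ Y Y′} →
    HasContainers G b a m Y → HasContainers G b a′ m′ Y′ →
    HasContainers G b (a + a′) (m + m′) (λ x → Y x ⊎ Y′ x)
  containers-∪ {a} {a′} {m} {m′} c c′ = record
    { family  = unions
    ; few     = begin
        length unions ≡⟨ length-cartesianProductWith _∪_ (family c) (family c′) ⟩
        length (family c) * length (family c′) ≤⟨ *-mono-≤ (few c) (few c′) ⟩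
        2 ^ m * 2 ^ m′ ≡⟨ ^-distribˡ-+-* 2 m m′ ⟨
        2 ^ (m + m′) ∎
    ; sparse  = sparse′
    ; capture = λ H αH →
        let F  , F∈  , sub  = capture c H αH
            F′ , F′∈ , sub′ = capture c′ H αH
        in F ∪ F′ , ∈-cartesianProductWith⁺ _∪_ F∈ F′∈ ,
           λ { x∈ (inj₁ y) → Subset.x∈p∪q⁺ (inj₁ (sub x∈ y))
             ; x∈ (inj₂ y) → Subset.x∈p∪q⁺ (inj₂ (sub′ x∈ y)) }
    }
    where
    open ≤-Reasoning
    unions = cartesianProductWith _∪_ (family c) (family c′)
    sparse′ : ∀ {F} → F ∈ unions → α G F ≤ a + a′
    sparse′ F∈
      with X , Y , X∈ , Y∈ , refl ← ∈-cartesianProductWith⁻ _∪_ (family c) (family c′) F∈ =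
      ≤-trans (α-∪ G X Y) (+-mono-≤ (sparse c X∈) (sparse c′ Y∈))

  containers-⋃ : ∀ {A : Set} {a m} {Y : A → Pred (Fin n) 0ℓ} xs →
    (∀ {y} → y ∈ xs → HasContainers G b a m (Y y)) →
    HasContainers G b (length xs * a) (length xs * m) (λ x → Any (λ y → Y y x) xs)
  containers-⋃ []       _ =
    containers-mono (≤-trans (α≤∣∣ G Subset.⊥) (≤-reflexive (Subset.∣⊥∣≡0 n))) ≤-refl (λ ())
      (containers-single Subset.⊥)
  containers-⋃ (y ∷ ys) c =
    containers-mono ≤-refl ≤-refl (λ { (here p) → inj₁ p ; (there p) → inj₂ p })
      (containers-∪ (c (here refl)) (containers-⋃ ys (c ∘ there)))

  private
    -- Intermediate form of a choice: families are concatenated, and the sum of their sizes is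
    -- tracked as a multiple of `2 ^ m` until the whole list has been processed.
    record Alternatives {A : Set} (a m : ℕ) (Y : A → Pred (Fin n) 0ℓ) (xs : List A) : Set where
      field
        family  : List (Subset n)
        few     : length family ≤ length xs * 2 ^ m
        sparse  : ∀ {F} → F ∈ family → α G F ≤ a
        capture : ∀ {y} → y ∈ xs → ∀ H → α G H ≤ b →
                  ∃[ F ] F ∈ family × (∀ {x} → x Subset.∈ H → Y y x → x Subset.∈ F)

    alternatives : ∀ {A : Set} {a m} {Y : A → Pred (Fin n) 0ℓ} xs →
      (∀ {y} → y ∈ xs → HasContainers G b a m (Y y)) → Alternatives a m Y xs
    alternatives []       c = record
      { family = [] ; few = z≤n ; sparse = λ () ; capture = λ () }
    alternatives {a = a} {m} {Y} (y ∷ ys) c = record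
      { family  = family c₀ ++ family′
      ; few     = ≤-trans (≤-reflexive (length-++ (family c₀))) (+-mono-≤ (few c₀) few′)
      ; sparse  = sparse″
      ; capture = capture″
      }
      where
      c₀ = c (here refl)
      open Alternatives (alternatives ys (c ∘ there)) renaming
        (family to family′; few to few′; sparse to sparse′; capture to capture′)
      sparse″ : ∀ {F} → F ∈ family c₀ ++ family′ → α G F ≤ a
      sparse″ F∈ with ∈-++⁻ (family c₀) F∈
      ... | inj₁ F∈₁ = sparse c₀ F∈₁
      ... | inj₂ F∈₂ = sparse′ F∈₂
      capture″ : ∀ {z} → z ∈ y ∷ ys → ∀ H → α G H ≤ b →
        ∃[ F ] F ∈ family c₀ ++ family′ × (∀ {x} → x Subset.∈ H → Y z x → x Subset.∈ F)
      capture″ (here refl) H αH =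
        let F , F∈ , sub = capture c₀ H αH in F , ∈-++⁺ˡ F∈ , sub
      capture″ (there z∈)  H αH =
        let F , F∈ , sub = capture′ z∈ H αH in F , ∈-++⁺ʳ (family c₀) F∈ , sub

  -- For a given `H` one good `y` suffices, so the families are put side by side instead of
  -- multiplied: guessing `y` costs `c` in the exponent and nothing in sparsity.
  containers-choice : ∀ {A : Set} {a m c Z} {Y : A → Pred (Fin n) 0ℓ} xs →
    length xs ≤ 2 ^ c →
    (∀ {y} → y ∈ xs → HasContainers G b a m (Y y)) →
    (∀ H → α G H ≤ b → ∃[ y ] y ∈ xs × (∀ {x} → x Subset.∈ H → Z x → Y y x)) →
    HasContainers G b a (c + m) Z
  containers-choice {m = m} {c} xs len cs choose = record
    { family  = family′
    ; few     = ≤-trans few′ (≤-trans (*-monoˡ-≤ (2 ^ m) len)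
                                      (≤-reflexive (sym (^-distribˡ-+-* 2 c m))))
    ; sparse  = sparse′
    ; capture = λ H αH →
        let y , y∈ , sub = choose H αH
            F , F∈ , sub′ = capture′ y∈ H αH
        in F , F∈ , λ x∈ z → sub′ x∈ (sub x∈ z)
    }
    where
    open Alternatives (alternatives xs cs) renaming
      (family to family′; few to few′; sparse to sparse′; capture to capture′)

-- Independent sets as lists, and domination.

module _ {n} (G : Graph n) where

  -- Lists rather than subsets, so that `take` cuts out sets of a prescribed size and the counting
  -- lemmas apply directly.
  record IndependentList (X : Subset n) (m : ℕ) (I : List (Fin n)) : Set where
    field
      size        : length I ≡ m
      distinct    : Unique I
      nonadjacent : ∀ {u v} → u ∈ I → v ∈ I → adj G u v ≡ false
      contained   : ∀ {u} → u ∈ I → u Subset.∈ X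

  open IndependentList

  independentList? : ∀ X m → Decidable (IndependentList X m)
  independentList? X m I = map′
    (λ { (s , d , na , c) → record
         { size = s ; distinct = d
         ; nonadjacent = λ u∈ v∈ → All.lookup (All.lookup na u∈) v∈
         ; contained = All.lookup c } })
    (λ i → size i , distinct i
         , All.tabulate (λ u∈ → All.tabulate (nonadjacent i u∈))
         , All.tabulate (contained i))
    ((length I ≟ m) ×-dec unique? Fin._≟_ I
      ×-dec All.all? (λ u → All.all? (λ v → adj G u v Bool.≟ false) I) I
      ×-dec All.all? (Subset._∈? X) I)

  independentList-⊆ : ∀ {X m I I′} → IndependentList X m I′ → (∀ {u} → u ∈ I → u ∈ I′) →
                      Unique I → IndependentList X (length I) I
  independentList-⊆ ind I⊆I′ d = record
    { size = refl ; distinct = d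
    ; nonadjacent = λ u∈ v∈ → nonadjacent ind (I⊆I′ u∈) (I⊆I′ v∈)
    ; contained = contained ind ∘ I⊆I′ }

  elements-independent : ∀ {X S} → S Subset.⊆ X → Independent G S →
                         IndependentList X ∣ S ∣ (elements S)
  elements-independent {X} {S} S⊆X ind = record
    { size        = length-elements S
    ; distinct    = elements-unique S
    ; nonadjacent = λ u∈ v∈ → ind _ _ (∈-elements⁻ u∈) (∈-elements⁻ v∈)
    ; contained   = λ u∈ → S⊆X (∈-elements⁻ u∈)
    }

  take-⊆ : ∀ k (I : List (Fin n)) {u} → u ∈ take k I → u ∈ I
  take-⊆ k I = All.lookup (All.take⁺ k (All.tabulate (λ u∈ → u∈)))

  take-independent : ∀ {X m I} k → k ≤ m → IndependentList X m I →
                     IndependentList X k (take k I)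
  take-independent {X} {m} {I} k k≤m ind =
    subst (λ j → IndependentList X j (take k I)) take-size
      (independentList-⊆ ind (take-⊆ k I) (Unique.take⁺ k (distinct ind)))
    where
    take-size : length (take k I) ≡ k
    take-size = trans (length-take k I)
      (m≤n⇒m⊓n≡m (≤-trans k≤m (≤-reflexive (sym (size ind)))))

  filter-independent : ∀ {X m I} {P : Pred (Fin n) 0ℓ} (P? : Decidable P) →
    IndependentList X m I → IndependentList X (count P? I) (filter P? I)
  filter-independent P? ind = independentList-⊆ ind (proj₁ ∘ ∈-filter⁻ P?)
    (Unique.filter⁺ P? (distinct ind))

  -- A larger independent set could be truncated to one of size exactly `s`.
  α-≤-of-none : ∀ {X s} → (∀ {S} → ¬ IndependentList X s S) → α G X ≤ s
  α-≤-of-none {X} {s} none with S , S⊆X , ind , eq ← α-attained G X =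
    ≮⇒≥ λ s<α → none (take-independent s (≤-trans (<⇒≤ s<α) (≤-reflexive (sym eq)))
                        (elements-independent S⊆X ind))

  -- A maximum independent set is dominating.
  dominating-list : ∀ X → ∃[ T ] IndependentList X (α G X) T ×
    (∀ {x} → x Subset.∈ X → x ∈ T ⊎ Any (λ v → adj G v x ≡ true) T)
  dominating-list X with S , S⊆X , ind , eq ← α-attained G X =
    elements S ,
    subst (λ m → IndependentList X m (elements S)) eq (elements-independent S⊆X ind) ,
    dominates
    where
    dominates : ∀ {x} → x Subset.∈ X →
                x ∈ elements S ⊎ Any (λ v → adj G v x ≡ true) (elements S)
    dominates {x} x∈X with x Subset.∈? S | any? (λ v → adj G v x Bool.≟ true) (elements S)
    ... | yes x∈S | _     = inj₁ (∈-elements⁺ x∈S)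
    ... | no _    | yes p = inj₂ p
    ... | no x∉S  | no ¬p = contradiction (α-maximal G S′⊆X ind′) (<⇒≱ larger)
      where
      S′ = S ∪ ⁅ x ⁆
      larger : α G X < ∣ S′ ∣
      larger = subst (_< ∣ S′ ∣) eq (Subset.p⊂q⇒∣p∣<∣q∣
        (Subset.p⊆p∪q ⁅ x ⁆ , x , Subset.q⊆p∪q S ⁅ x ⁆ (Subset.x∈⁅x⁆ x) , x∉S))
      S′⊆X : S′ Subset.⊆ X
      S′⊆X u∈ with Subset.x∈p∪q⁻ S ⁅ x ⁆ u∈
      ... | inj₁ u∈S = S⊆X u∈S
      ... | inj₂ u≡x rewrite Subset.x∈⁅y⁆⇒x≡y x u≡x = x∈X
      nonadj : ∀ {v} → v Subset.∈ S → adj G v x ≡ false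
      nonadj v∈S = Bool.¬-not λ e → ¬p (lose (∈-elements⁺ v∈S) e)
      ind′ : Independent G S′
      ind′ u v u∈ v∈ with Subset.x∈p∪q⁻ S ⁅ x ⁆ u∈ | Subset.x∈p∪q⁻ S ⁅ x ⁆ v∈
      ... | inj₁ u∈S | inj₁ v∈S = ind u v u∈S v∈S
      ... | inj₁ u∈S | inj₂ v≡x rewrite Subset.x∈⁅y⁆⇒x≡y x v≡x = nonadj u∈S
      ... | inj₂ u≡x | inj₁ v∈S rewrite Subset.x∈⁅y⁆⇒x≡y x u≡x =
        trans (symm G x v) (nonadj v∈S)
      ... | inj₂ u≡x | inj₂ v≡x
        rewrite Subset.x∈⁅y⁆⇒x≡y x u≡x | Subset.x∈⁅y⁆⇒x≡y x v≡x = loopless G x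

-- Bernoulli's inequality and geometric decay.

-- Bernoulli's inequality `1 + t/x ≤ (1 + 1/x)^t`, multiplied by `x * x ^ t`.
bernoulli : ∀ x t → (x + t) * x ^ t ≤ x * suc x ^ t
bernoulli x zero    = ≤-reflexive (cong (_* 1) (+-identityʳ x))
bernoulli x (suc t) = begin
  (x + suc t) * (x * x ^ t)        ≤⟨ m≤m+n _ (t * x ^ t) ⟩
  (x + suc t) * (x * x ^ t) + t * x ^ t  ≡⟨ regroup x t (x ^ t) ⟩
  suc x * ((x + t) * x ^ t)        ≤⟨ *-monoʳ-≤ (suc x) (bernoulli x t) ⟩
  suc x * (x * suc x ^ t)          ≡⟨ swap (suc x) x (suc x ^ t) ⟩
  x * (suc x * suc x ^ t)          ∎
  where
  open ≤-Reasoning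
  regroup : ∀ x t p → (x + suc t) * (x * p) + t * p ≡ suc x * ((x + t) * p)
  regroup = solve-∀
  swap : ∀ x y z → x * (y * z) ≡ y * (x * z)
  swap = solve-∀

-- The case `t = 1 + x` of Bernoulli's inequality gives `(1 + 1/x)^(1+x) ≥ 2`.
2*x^1+x≤[1+x]^1+x : ∀ x → .{{NonZero x}} → 2 * x ^ suc x ≤ suc x ^ suc x
2*x^1+x≤[1+x]^1+x x = *-cancelˡ-≤ x (begin
  x * (2 * x ^ suc x)          ≡⟨ double x (x ^ suc x) ⟩
  (x + x) * x ^ suc x          ≤⟨ *-monoˡ-≤ (x ^ suc x) (+-monoʳ-≤ x (n≤1+n x)) ⟩
  (x + suc x) * x ^ suc x      ≤⟨ bernoulli x (suc x) ⟩
  x * suc x ^ suc x            ∎)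
  where
  open ≤-Reasoning
  double : ∀ x p → x * (2 * p) ≡ (x + x) * p
  double = solve-∀

^-*-distribʳ : ∀ m n o → (m * n) ^ o ≡ m ^ o * n ^ o
^-*-distribʳ m n zero    = refl
^-*-distribʳ m n (suc o) =
  trans (cong (m * n *_) (^-*-distribʳ m n o)) ([m*n]*[o*p]≡[m*o]*[n*p] m n (m ^ o) (n ^ o))

-- With `K = suc x` this is `n * (1 - 1/K)^(K * l) < 1`: every block of `K` factors at least halves.
-- It ends the greedy covering of the high vertices.
shrinking : ∀ {n l} x → .{{NonZero x}} → n < 2 ^ l →
            n * x ^ (suc x * l) < suc x ^ (suc x * l)
shrinking {n} {l} x n<2^l = begin-strict
  n * x ^ (suc x * l)        <⟨ *-monoˡ-< (x ^ (suc x * l)) {{m^n≢0 x (suc x * l)}} n<2^l ⟩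
  2 ^ l * x ^ (suc x * l)    ≡⟨ cong (2 ^ l *_) (^-*-assoc x (suc x) l) ⟨
  2 ^ l * (x ^ suc x) ^ l    ≡⟨ ^-*-distribʳ 2 (x ^ suc x) l ⟨
  (2 * x ^ suc x) ^ l        ≤⟨ ^-monoˡ-≤ l (2*x^1+x≤[1+x]^1+x x) ⟩
  (suc x ^ suc x) ^ l        ≡⟨ ^-*-assoc (suc x) (suc x) l ⟩
  suc x ^ (suc x * l)        ∎
  where open ≤-Reasoning

-- The inductive step inside a set `X₀`.

module Step {n} (G : Graph n) (b k l a m : ℕ) .{{_ : NonZero b}} .{{_ : NonZero k}}
  (n<2^l : n < 2 ^ l) (X₀ : Subset n)
  (hyp : ∀ {I} → IndependentList G X₀ k I →
         HasContainers G b a m (λ x → x Subset.∈ X₀ × All (λ u → adj G x u ≡ true) I))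
  where

  open IndependentList

  -- `s` is the size of the sets in `𝓢`, `w` bounds the number of `k`-subsets of one of them, and
  -- `1 / K` is the threshold for high vertices. `K` equals `2 * b`, but as an explicit successor it
  -- lets `K * x` unfold to `x + pred K * x`.
  s w K : ℕ
  s = b * k
  w = suc s ^ k
  K = suc (pred (2 * b))

  degree : Fin n → List (Fin n) → ℕ
  degree x = count (λ u → adj G x u Bool.≟ true)

  Hits : Fin n → List (Fin n) → Set
  Hits x S = k ≤ degree x S

  hits? : ∀ x S → Dec (Hits x S)
  hits? x S = k ≤? degree x S

  -- A vertex hit by `S` is complete to `k` of its neighbours in `S`, which form an independent
  -- `k`-set. So `hyp` is applied to each of the at most `w` candidates and the results are united.
  containers-hit : ∀ {S} → IndependentList G X₀ s S →
    HasContainers G b (w * a) (w * m) (λ x → x Subset.∈ X₀ × Hits x S)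
  containers-hit {S} ind = containers-mono (*-monoˡ-≤ a Is≤w) (*-monoˡ-≤ m Is≤w) common
    (containers-⋃ Is (λ I∈ → hyp (proj₂ (∈-filter⁻ good? {xs = lists≤ k S} I∈))))
    where
    good? = independentList? G X₀ k
    Is = filter good? (lists≤ k S)
    Is≤w : length Is ≤ w
    Is≤w = ≤-trans (length-filter good? (lists≤ k S))
             (≤-trans (length-lists≤ k S) (≤-reflexive (cong (λ i → suc i ^ k) (size ind))))
    common : ∀ {x} → x Subset.∈ X₀ × Hits x S →
             Any (λ I → x Subset.∈ X₀ × All (λ u → adj G x u ≡ true) I) Is
    common {x} (x∈ , hit) = lose
      (∈-filter⁺ good?
        (∈-lists≤ (≤-reflexive (size I-ind)) (λ u∈ → proj₁ (I-nbr u∈))) I-ind)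
      (x∈ , All.tabulate (λ u∈ → proj₂ (I-nbr u∈)))
      where
      nbr? = λ u → adj G x u Bool.≟ true
      I = take k (filter nbr? S)
      I-ind : IndependentList G X₀ k I
      I-ind = take-independent G k hit (filter-independent G nbr? ind)
      I-nbr : ∀ {u} → u ∈ I → u ∈ S × adj G x u ≡ true
      I-nbr u∈ = ∈-filter⁻ nbr? (take-⊆ G k (filter nbr? S) u∈)

  module _ (𝓢 : List (List (Fin n)))
           (𝓢-independent : ∀ {S} → S ∈ 𝓢 → IndependentList G X₀ s S) where

    High : Fin n → Set
    High v = length 𝓢 < K * count (hits? v) 𝓢

    high? : Decidable High
    high? v = length 𝓢 <? K * count (hits? v) 𝓢

    -- Greedy cover: by averaging some `S` hits at least `1 / K` of `Y`; the vertices it hits go to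
    -- `containers-hit`, the rest to the remaining rounds. The numerical hypothesis says
    -- `length Y * (1 - 1/K)^t < 1`.
    containers-high : ∀ t Y → (∀ {v} → v ∈ Y → v Subset.∈ X₀ × High v) →
      length Y * pred K ^ t < K ^ t →
      HasContainers G b (t * (w * a)) (t * (w * m)) (_∈ Y)
    containers-high t       []        _     _     =
      containers-mono z≤n z≤n (λ ()) 
        (containers-⋃ {A = Fin n} {a = 0} {m = 0} {Y = λ _ → ∅} [] λ ())
    -- With no round left the numerical hypothesis reads `length Y * 1 < 1`.
    containers-high zero    (_ ∷ _)   _     (s≤s ())
    containers-high (suc t) Y@(_ ∷ _) Yhigh small
      with averaging hits? K Y 𝓢 z<s (proj₂ ∘ Yhigh)
    ... | S , S∈ , hitting =
      containers-mono ≤-refl ≤-refl split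
        (containers-∪ (containers-hit (𝓢-independent S∈))
                      (containers-high t Y′ (Yhigh ∘ proj₁ ∘ ∈-filter⁻ ¬hits?) small′))
      where
      ¬hits? = λ v → ¬? (hits? v S)
      Y′ = filter ¬hits? Y
      split : ∀ {x} → x ∈ Y → (x Subset.∈ X₀ × Hits x S) ⊎ x ∈ Y′
      split {x} x∈ with hits? x S
      ... | yes h = inj₁ (proj₁ (Yhigh x∈) , h)
      ... | no ¬h = inj₂ (∈-filter⁺ ¬hits? x∈ ¬h)
      open ≤-Reasoning
      h = count (λ v → hits? v S) Y
      K∣Y′∣≤ : K * length Y′ ≤ pred K * length Y
      -- Adding `length Y` on both sides reduces the claim to `length Y ≤ K * h`.
      K∣Y′∣≤ = +-cancelʳ-≤ (length Y) _ _ (begin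
        K * length Y′ + length Y       ≤⟨ +-monoʳ-≤ (K * length Y′) hitting ⟩
        K * length Y′ + K * h          ≡⟨ +-comm (K * length Y′) (K * h) ⟩
        K * h + K * length Y′          ≡⟨ *-distribˡ-+ K h (length Y′) ⟨
        K * (h + length Y′)            ≡⟨ cong (K *_) (count-complement (λ v → hits? v S) Y) ⟩
        length Y + pred K * length Y   ≡⟨ +-comm (length Y) _ ⟩
        pred K * length Y + length Y   ∎)
      swap : ∀ x y z → x * y * z ≡ y * (x * z)
      swap = solve-∀
      small′ : length Y′ * pred K ^ t < K ^ t
      small′ = *-cancelˡ-< K _ _ (begin-strict
        K * (length Y′ * pred K ^ t)        ≡⟨ *-assoc K (length Y′) _ ⟨
        K * length Y′ * pred K ^ t          ≤⟨ *-monoˡ-≤ (pred K ^ t) K∣Y′∣≤ ⟩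
        pred K * length Y * pred K ^ t      ≡⟨ swap (pred K) (length Y) _ ⟩
        length Y * pred K ^ suc t           <⟨ small ⟩
        K * K ^ t                           ∎)

  K≡2*b : K ≡ 2 * b
  K≡2*b = suc-pred (2 * b) {{m*n≢0 2 b}}

  instance
    pred-K-nonZero : NonZero (pred K)
    pred-K-nonZero = >-nonZero (begin-strict
      0              <⟨ s≤s z≤n ⟩
      1              ≤⟨ pred-mono-≤ (*-monoʳ-≤ 2 (>-nonZero⁻¹ b)) ⟩
      pred (2 * b)   ∎)
      where open ≤-Reasoning

  containers-list : ∀ T → HasContainers G b (length T) 0 (_∈ T)
  containers-list T = containers-mono
    (≤-reflexive (*-identityʳ _)) (≤-reflexive (*-zeroʳ (length T)))
    (Any.map λ { {v} refl → Subset.x∈⁅x⁆ v })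
    (containers-⋃ T λ {v} _ →
      containers-mono (≤-trans (α≤∣∣ G ⁅ v ⁆) (≤-reflexive (Subset.∣⁅x⁆∣≡1 v))) ≤-refl
        (λ x∈ → x∈) (containers-single ⁅ v ⁆))

  adjacent? : ∀ T → Decidable (λ x → Any (λ v → adj G v x ≡ true) T)
  adjacent? T x = any? (λ v → adj G v x Bool.≟ true) T

  neighbours : List (Fin n) → Subset n
  neighbours T = ⟪ adjacent? T ⟫

  -- Pigeonhole: s = b k vertices are shared among at most b neighbourhoods.
  neighbours-hit : ∀ {X S} T → length T ≤ b →
    IndependentList G (X ∩ neighbours T) s S → Any (λ v → Hits v S) T
  neighbours-hit {X} {S} T T≤b ind with any? (λ v → hits? v S) T
  ... | yes hit = hit
  ... | no ¬hit = contradiction bound (<⇒≱ (begin-strict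
    length T * pred k  ≤⟨ *-monoˡ-≤ (pred k) T≤b ⟩
    b * pred k         <⟨ *-monoʳ-< b (≤-reflexive (suc-pred k)) ⟩
    b * k              ≡⟨ size ind ⟨
    length S           ≡⟨ *-identityˡ (length S) ⟨
    1 * length S       ∎))
    where
    open ≤-Reasoning
    bound : 1 * length S ≤ length T * pred k
    bound = union-bound (λ v u → adj G v u Bool.≟ true) 1 (pred k) T S
      (λ v∈ → ≤-trans (≤-reflexive (*-identityˡ _)) (pred-mono-≤ (≰⇒> (¬hit ∘ lose v∈))))
      (λ u∈ → ∈⟪⟫⁻ (adjacent? T) (proj₂ (Subset.x∈p∩q⁻ X (neighbours T) (contained ind u∈))))

  -- Induction on `R`; the invariant is that `𝓢` contains every independent `s`-list of `X` and has
  -- fewer than `2 ^ R` members. A round guesses `T`, covers the high vertices and `T` separately,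
  -- and recurses into `X ∩ neighbours T` with at most half of `𝓢`. Members of `𝓢` are kept in `X₀`,
  -- where `hyp` applies.
  rounds : ∀ R X 𝓢 → X Subset.⊆ X₀ →
    (∀ {S} → S ∈ 𝓢 → IndependentList G X₀ s S) →
    (∀ {S} → IndependentList G X s S → S ∈ 𝓢) →
    length 𝓢 < 2 ^ R →
    HasContainers G b (s + R * (K * l * (w * a) + b)) (R * (K * l * (w * m) + l * b))
                  (Subset._∈ X)
  -- Now `𝓢` is empty, so `X` has independence number at most `s` and is its own container.
  rounds zero    X []      _    _   complete _ =
    containers-mono (≤-trans (α-≤-of-none G λ ind → contradiction (complete ind) λ ())
                             (m≤m+n s 0))
      z≤n (λ x∈ → x∈) (containers-single X)
  rounds zero    X (_ ∷ _) _    _   complete (s≤s ())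
  rounds (suc R) X 𝓢       X⊆X₀ ind complete small =
    containers-mono ≤-refl (≤-reflexive (m-eq (l * b) (K * l * (w * m)) _)) (λ x∈ → x∈)
      (containers-choice {c = l * b} Ts Ts-few
        (branch ∘ proj₂ ∘ ∈-filter⁻ T? {xs = lists≤ b (allFin n)}) choose)
    where
    m-eq : ∀ x y z → x + (y + z) ≡ y + x + z
    m-eq = solve-∀
    a-eq : ∀ x y z t → x + (y + (z + t)) ≡ z + (x + y + t)
    a-eq = solve-∀

    Hi? = high? 𝓢 ind
    Hi  = High 𝓢 ind
    low? = λ v → ¬? (Hi? v)
    highs = filter Hi? (elements X)
    low = X ∩ ⟪ low? ⟫

    T? = λ T → (length T ≤? b) ×-dec All.all? low? T
    -- All short lists of low vertices are allowed as guesses; lowness is what makes the halving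
    -- below work.
    Ts = filter T? (lists≤ b (allFin n))

    Ts-few : length Ts ≤ 2 ^ (l * b)
    Ts-few = begin
      length Ts                         ≤⟨ length-filter T? (lists≤ b (allFin n)) ⟩
      length (lists≤ b (allFin n))      ≤⟨ length-lists≤ b (allFin n) ⟩
      suc (length (allFin n)) ^ b       ≡⟨ cong (λ i → suc i ^ b) (length-allFin n) ⟩
      suc n ^ b                         ≤⟨ ^-monoˡ-≤ b n<2^l ⟩
      (2 ^ l) ^ b                       ≡⟨ ^-*-assoc 2 l b ⟩
      2 ^ (l * b)                       ∎
      where open ≤-Reasoning

    Target : List (Fin n) → Pred (Fin n) 0ℓ
    Target T x = x ∈ highs ⊎ (x ∈ T ⊎ x Subset.∈ X ∩ neighbours T)

    highs-small : length highs * pred K ^ (K * l) < K ^ (K * l)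
    highs-small = shrinking {l = l} (pred K) (begin-strict
      length highs           ≤⟨ length-filter Hi? (elements X) ⟩
      length (elements X)    ≡⟨ length-elements X ⟩
      ∣ X ∣                  ≤⟨ Subset.∣p∣≤n X ⟩
      n                      <⟨ n<2^l ⟩
      2 ^ l                  ∎)
      where open ≤-Reasoning

    branch : ∀ {T} → length T ≤ b × All (λ v → ¬ Hi v) T →
      HasContainers G b (s + suc R * (K * l * (w * a) + b))
                    (K * l * (w * m) + R * (K * l * (w * m) + l * b)) (Target T)
    branch {T} (T≤b , T-low) = containers-mono
      (≤-trans (+-monoʳ-≤ (K * l * (w * a)) (+-monoˡ-≤ _ T≤b))
               (≤-reflexive (a-eq (K * l * (w * a)) b s _)))
      ≤-refl (λ x∈ → x∈)
      (containers-∪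
        (containers-high 𝓢 ind (K * l) highs
          (λ v∈ → let v∈X , hi = ∈-filter⁻ Hi? {xs = elements X} v∈ in
                  X⊆X₀ (∈-elements⁻ v∈X) , hi)
          highs-small)
        (containers-∪ (containers-list T)
          (rounds R (X ∩ neighbours T) 𝓢′ (X⊆X₀ ∘ Subset.p∩q⊆p X _)
            (ind ∘ proj₁ ∘ ∈-filter⁻ hit?) complete′ halved)))
      where
      hit? = λ S → any? (λ v → hits? v S) T
      -- Some members may lie outside `neighbours T`; the invariant asks only that those inside are
      -- kept, which is `neighbours-hit`.
      𝓢′ = filter hit? 𝓢
      complete′ : ∀ {S} → IndependentList G (X ∩ neighbours T) s S → S ∈ 𝓢′
      complete′ ind′ = ∈-filter⁺ hit?
        (complete record
          { size = size ind′ ; distinct = distinct ind′ ; nonadjacent = nonadjacent ind′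
          ; contained = Subset.p∩q⊆p X _ ∘ contained ind′ })
        (neighbours-hit {X} T T≤b ind′)
      open ≤-Reasoning
      halved : length 𝓢′ < 2 ^ R
      -- Each of the at most `b` vertices of `T` is low, so it hits at most `1 / K` of `𝓢`; together
      -- they hit at most the fraction `b / K`, one half.
      halved = *-cancelˡ-< K _ _ (begin-strict
        K * length 𝓢′       ≤⟨ union-bound hits? K (length 𝓢) T 𝓢′
                                 (λ v∈ → ≤-trans (*-monoʳ-≤ K (count-filter-≤ (hits? _) hit? 𝓢))
                                                 (≮⇒≥ (All.lookup T-low v∈)))
                                 (proj₂ ∘ ∈-filter⁻ hit? {xs = 𝓢}) ⟩
        length T * length 𝓢 ≤⟨ *-monoˡ-≤ (length 𝓢) T≤b ⟩
        b * length 𝓢        <⟨ *-monoʳ-< b small ⟩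
        b * (2 * 2 ^ R)     ≡⟨ regroup b (2 ^ R) ⟩
        2 * b * 2 ^ R       ≡⟨ cong (_* 2 ^ R) K≡2*b ⟨
        K * 2 ^ R           ∎)
        where
        regroup : ∀ x y → x * (2 * y) ≡ 2 * x * y
        regroup = solve-∀

    choose : ∀ H → α G H ≤ b →
      ∃[ T ] T ∈ Ts × (∀ {x} → x Subset.∈ H → x Subset.∈ X → Target T x)
    -- `T` is a maximum independent set of the low part of `H` in `X`, so every other vertex of that
    -- part has a neighbour in `T`; the high vertices are in `highs`.
    choose H αH≤b with T , T-ind , dominating ← dominating-list G (H ∩ low) =
      T , ∈-filter⁺ T? (∈-lists≤ T≤b (λ _ → ∈-allFin _)) (T≤b , All.tabulate T-low) , target
      where
      T≤b : length T ≤ b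
      T≤b = ≤-trans (≤-reflexive (size T-ind))
                    (≤-trans (α-mono G (Subset.p∩q⊆p H low)) αH≤b)
      T-low : ∀ {v} → v ∈ T → ¬ Hi v
      T-low v∈ = ∈⟪⟫⁻ low? (Subset.p∩q⊆q X _ (Subset.p∩q⊆q H low (contained T-ind v∈)))
      target : ∀ {x} → x Subset.∈ H → x Subset.∈ X → Target T x
      target {x} x∈H x∈X with Hi? x
      ... | yes hi = inj₁ (∈-filter⁺ Hi? (∈-elements⁺ x∈X) hi)
      ... | no ¬hi
        with dominating (Subset.x∈p∩q⁺ (x∈H , Subset.x∈p∩q⁺ (x∈X , ∈⟪⟫⁺ low? ¬hi)))
      ...   | inj₁ x∈T = inj₂ (inj₁ x∈T)
      ...   | inj₂ nbr = inj₂ (inj₂ (Subset.x∈p∩q⁺ (x∈X , ∈⟪⟫⁺ (adjacent? T) nbr)))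

  -- The rounds start with all independent `s`-lists of `X₀`, at most `(n + 1)^s ≤ 2 ^ (l * s)` of
  -- them; the extra round in `suc (l * s)` makes the bound strict.
  containers-step :
    HasContainers G b (s + suc (l * s) * (K * l * (w * a) + b))
                  (suc (l * s) * (K * l * (w * m) + l * b)) (Subset._∈ X₀)
  containers-step = rounds (suc (l * s)) X₀ 𝓢 (λ x∈ → x∈)
    (proj₂ ∘ ∈-filter⁻ ind? {xs = lists≤ s (allFin n)})
    (λ ind → ∈-filter⁺ ind? (∈-lists≤ (≤-reflexive (size ind)) (λ _ → ∈-allFin _)) ind)
    (begin-strict
      length 𝓢                          ≤⟨ length-filter ind? (lists≤ s (allFin n)) ⟩
      length (lists≤ s (allFin n))      ≤⟨ length-lists≤ s (allFin n) ⟩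
      suc (length (allFin n)) ^ s       ≡⟨ cong (λ i → suc i ^ s) (length-allFin n) ⟩
      suc n ^ s                         ≤⟨ ^-monoˡ-≤ s n<2^l ⟩
      (2 ^ l) ^ s                       ≡⟨ ^-*-assoc 2 l s ⟩
      2 ^ (l * s)                       <⟨ ^-monoʳ-< 2 (s≤s (s≤s z≤n)) (n<1+n (l * s)) ⟩
      2 ^ suc (l * s)                   ∎)
    where
    open ≤-Reasoning
    ind? = independentList? G X₀ s
    𝓢 = filter ind? (lists≤ s (allFin n))

-- Induction on the number of parts.

lookup-injective : {A : Set} {xs : List A} → Unique xs → Injective _≡_ _≡_ (lookup xs)
lookup-injective (_  ∷ _)  {zero}  {zero}  _  = refl
lookup-injective (x∉ ∷ _)  {zero}  {suc j} eq = contradiction eq (All.lookup x∉ (∈-lookup j))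
lookup-injective (x∉ ∷ _)  {suc i} {zero}  eq = contradiction (sym eq) (All.lookup x∉ (∈-lookup i))
lookup-injective (_  ∷ xs) {suc i} {suc j} eq = cong suc (lookup-injective xs eq)

-- Here and in `exponent`, the bounds of `containers-step` are iterated with `2 * b` for `K`. For
-- fixed `k` and `r` they are polynomial in `b` and `l`.
sparsity : (b k l r : ℕ) → ℕ
sparsity b k l zero    = 0
sparsity b k l (suc r) =
  b * k + suc (l * (b * k)) * (2 * b * l * (suc (b * k) ^ k * sparsity b k l r) + b)

exponent : (b k l r : ℕ) → ℕ
exponent b k l zero    = 0
exponent b k l (suc r) =
  suc (l * (b * k)) * (2 * b * l * (suc (b * k) ^ k * exponent b k l r) + l * b)

module _ {n} (G : Graph n) where

  completeTo? : ∀ I → Decidable (λ x → All (λ u → adj G x u ≡ true) I)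
  completeTo? I x = All.all? (λ u → adj G x u Bool.≟ true) I

  -- The parts are nested, each followed by the others inside its common neighbourhood; this is the
  -- shape that the induction on `r` peels off.
  MultipartiteIn : (k r : ℕ) → Subset n → Set
  MultipartiteIn k zero    X = ⊤
  MultipartiteIn k (suc r) X =
    ∃[ I ] IndependentList G X k I × MultipartiteIn k r (X ∩ ⟪ completeTo? I ⟫)

  -- If the common neighbourhood of an independent `k`-set `I` contained `r` nested parts, `I` would
  -- complete them to `r + 1`. So the induction hypothesis applies to every such neighbourhood, as
  -- `Step` requires.
  containers-of-free : ∀ b k l → .{{NonZero b}} → .{{NonZero k}} → n < 2 ^ l →
    ∀ r X → ¬ MultipartiteIn k r X →
    HasContainers G b (sparsity b k l r) (exponent b k l r) (Subset._∈ X)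
  containers-of-free b k l n<2^l zero    X free = contradiction tt free
  containers-of-free b k l n<2^l (suc r) X free =
    subst (λ K → HasContainers G b
             (s + suc (l * s) * (K * l * (w * sparsity b k l r) + b))
             (suc (l * s) * (K * l * (w * exponent b k l r) + l * b)) (Subset._∈ X))
          K≡2*b containers-step
    where
    open Step G b k l (sparsity b k l r) (exponent b k l r) n<2^l X (λ {I} ind →
      containers-mono ≤-refl ≤-refl
        (λ (x∈X , complete) → Subset.x∈p∩q⁺ (x∈X , ∈⟪⟫⁺ (completeTo? I) complete))
        (containers-of-free b k l n<2^l r (X ∩ ⟪ completeTo? I ⟫)
          (λ multipartite → free (I , ind , multipartite))))

  open IndependentList

  record Parts (k r : ℕ) (X : Subset n) : Set where
    field
      vertex      : Fin r → Fin k → Fin n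
      vertex-in   : ∀ p i → vertex p i Subset.∈ X
      injective   : ∀ p → Injective _≡_ _≡_ (vertex p)
      nonadjacent : ∀ p i j → adj G (vertex p i) (vertex p j) ≡ false
      adjacent    : ∀ {p q} → p ≢ q → ∀ i j → adj G (vertex p i) (vertex q j) ≡ true

  parts : ∀ {k} r {X} → MultipartiteIn k r X → Parts k r X
  parts zero    _ = record
    { vertex = λ () ; vertex-in = λ () ; injective = λ () ; nonadjacent = λ ()
    ; adjacent = λ {} }
  parts (suc r) {X} (I , ind , multipartite) with refl ← size ind = record
    { vertex      = vertex′
    ; vertex-in   = λ { zero    i → contained ind (∈-lookup i)
                      ; (suc p) i → Subset.p∩q⊆p X _ (P.vertex-in p i) }
    ; injective   = λ { zero    → lookup-injective (distinct ind)
                      ; (suc p) → P.injective p }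
    ; nonadjacent = λ { zero    i j → nonadjacent ind (∈-lookup i) (∈-lookup j)
                      ; (suc p) i j → P.nonadjacent p i j }
    ; adjacent    = adjacent′
    }
    where
    module P = Parts (parts r multipartite)
    vertex′ : Fin (suc r) → Fin (length I) → Fin n
    vertex′ zero    = lookup I
    vertex′ (suc p) = P.vertex p
    cross : ∀ p i j → adj G (P.vertex p i) (lookup I j) ≡ true
    cross p i j = All.lookup
      (∈⟪⟫⁻ (completeTo? I) (Subset.p∩q⊆q X _ (P.vertex-in p i))) (∈-lookup j)
    adjacent′ : ∀ {p q} → p ≢ q → ∀ i j → adj G (vertex′ p i) (vertex′ q j) ≡ true
    adjacent′ {zero}  {zero}  p≢q i j = contradiction refl p≢q
    adjacent′ {zero}  {suc q} p≢q i j = trans (symm G _ _) (cross q j i)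
    adjacent′ {suc p} {zero}  p≢q i j = cross p i j
    adjacent′ {suc p} {suc q} p≢q i j = P.adjacent (p≢q ∘ cong suc) i j

-- The complement of `k` disjoint cliques as a multipartite graph.

module _ (k : ℕ) where

  multipartite : Graph (k * k)
  multipartite = complement (copies k (complete k))

  part index : Fin (k * k) → Fin k
  part  = quotient {k} k
  index = remainder {k} k

  part-index-injective : ∀ {u v} → part u ≡ part v → index u ≡ index v → u ≡ v
  part-index-injective {u} {v} p i =
    trans (sym (Fin.combine-remQuot {k} k u))
          (trans (cong₂ combine p i) (Fin.combine-remQuot {k} k v))

  multipartite-nonadjacent : ∀ {u v} → part u ≡ part v → adj multipartite u v ≡ false
  multipartite-nonadjacent {u} {v} p with u Fin.≟ v
  ... | yes _ = refl
  ... | no u≢v rewrite dec-true (part u Fin.≟ part v) p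
                     | dec-false (index u Fin.≟ index v) (u≢v ∘ part-index-injective p) = refl

  multipartite-adjacent : ∀ {u v} → part u ≢ part v → adj multipartite u v ≡ true
  multipartite-adjacent {u} {v} p
    rewrite dec-false (u Fin.≟ v) (p ∘ cong part)
          | dec-false (part u Fin.≟ part v) p = refl

  parts-embedding : ∀ {n} {G : Graph n} {X} → Parts G k k X → InducedEmbedding multipartite G
  parts-embedding {G = G} P = record
    { to = to
    ; injective = λ {u} {v} → inj u v
    ; preserves = pres
    }
    where
    open Parts P
    to = λ u → vertex (part u) (index u)
    pres : ∀ u v → adj multipartite u v ≡ adj G (to u) (to v)
    pres u v = by (part u Fin.≟ part v)
      where
      by : Dec (part u ≡ part v) → adj multipartite u v ≡ adj G (to u) (to v)
      by (no p≢)  = trans (multipartite-adjacent {u} {v} p≢) (sym (adjacent p≢ _ _))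
      by (yes p≡) = trans (multipartite-nonadjacent {u} {v} p≡)
        (sym (subst (λ p → adj G (to u) (vertex p (index v)) ≡ false) p≡ (nonadjacent _ _ _)))
    inj : ∀ u v → to u ≡ to v → u ≡ v
    inj u v eq with part u Fin.≟ part v
    ... | yes p≡ = part-index-injective {u} {v} p≡
      (injective (part u) {index u} {index v} (trans eq (cong (λ p → vertex p (index v)) (sym p≡))))
    -- The images are adjacent, so they cannot be the same vertex of a loopless graph.
    ... | no p≢  = contradiction
      (trans (sym (loopless G (to v))) (subst (λ x → adj G x (to v) ≡ true) eq (adjacent p≢ _ _)))
      λ ()

-- Lists turned into subsets.

fromList : ∀ {n} → List (Fin n) → Subset n
fromList []       = Subset.⊥
fromList (x ∷ xs) = ⁅ x ⁆ ∪ fromList xs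

∈-fromList⁺ : ∀ {n} {x : Fin n} {xs} → x ∈ xs → x Subset.∈ fromList xs
∈-fromList⁺ {xs = x ∷ _} (here refl) = Subset.x∈p∪q⁺ (inj₁ (Subset.x∈⁅x⁆ x))
∈-fromList⁺ (there x∈)               = Subset.x∈p∪q⁺ (inj₂ (∈-fromList⁺ x∈))

∈-fromList⁻ : ∀ {n} {x : Fin n} xs → x Subset.∈ fromList xs → x ∈ xs
∈-fromList⁻ []       x∈ = contradiction x∈ Subset.∉⊥
∈-fromList⁻ (y ∷ ys) x∈ with Subset.x∈p∪q⁻ ⁅ y ⁆ (fromList ys) x∈
... | inj₁ x∈y  = here (Subset.x∈⁅y⁆⇒x≡y y x∈y)
... | inj₂ x∈ys = there (∈-fromList⁻ ys x∈ys)

length≤∣fromList∣ : ∀ {n} {xs : List (Fin n)} → Unique xs → length xs ≤ ∣ fromList xs ∣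
length≤∣fromList∣ []                     = z≤n
length≤∣fromList∣ {xs = x ∷ xs} (x∉ ∷ u) =
  ≤-<-trans (length≤∣fromList∣ u) (Subset.p⊂q⇒∣p∣<∣q∣
    ( Subset.q⊆p∪q ⁅ x ⁆ (fromList xs)
    , x , Subset.x∈p∪q⁺ (inj₁ (Subset.x∈⁅x⁆ x))
    , λ x∈ → All.lookup x∉ (∈-fromList⁻ xs x∈) refl))

independentList-≤-α : ∀ {n} (G : Graph n) {X m I} → IndependentList G X m I → m ≤ α G X
independentList-≤-α G {X} {m} {I} ind = ≤-trans (≤-reflexive (sym (size ind)))
  (≤-trans (length≤∣fromList∣ (distinct ind))
    (α-maximal G (contained ind ∘ ∈-fromList⁻ I)
      (λ u v u∈ v∈ → nonadjacent ind (∈-fromList⁻ I u∈) (∈-fromList⁻ I v∈))))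
  where open IndependentList

injective-on-unique : {A B : Set} (f : A → B) {xs : List A} → Unique (map f xs) →
  ∀ {x y} → x ∈ xs → y ∈ xs → f x ≡ f y → x ≡ y
injective-on-unique f (_   ∷ _) (here refl) (here refl) _  = refl
injective-on-unique f (fx∉ ∷ _) (here refl) (there y∈)  eq =
  contradiction eq (All.lookup fx∉ (∈-map⁺ f y∈))
injective-on-unique f (fx∉ ∷ _) (there x∈)  (here refl) eq =
  contradiction (sym eq) (All.lookup fx∉ (∈-map⁺ f x∈))
injective-on-unique f (_   ∷ u) (there x∈)  (there y∈)  eq = injective-on-unique f u x∈ y∈ eq

-- A transversal that escapes few containers.

module _ (k : ℕ) where

  private G = multipartite k

  place : Fin k → Fin k → Fin (k * k)
  place = combine

  part-place : ∀ p i → part k (place p i) ≡ p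
  part-place p i = cong proj₁ (Fin.remQuot-combine {k} {k} p i)

  in? : ∀ p i (F : Subset (k * k)) → Dec (place p i Subset.∈ F)
  in? p i F = place p i Subset.∈? F

  -- A part is independent, hence so is the trace of `F` on it.
  part-count : ∀ p F → count (λ i → in? p i F) (allFin k) ≤ α G F
  part-count p F = independentList-≤-α G {I = map (place p) I} record
    { size        = length-map (place p) I
    ; distinct    = Unique.map⁺ (λ {i} {j} → Fin.combine-injectiveʳ p i p j)
                      (Unique.filter⁺ (λ i → in? p i F) (Unique.allFin⁺ k))
    ; nonadjacent = nonadj
    ; contained   = cont
    }
    where
    I = filter (λ i → in? p i F) (allFin k)
    nonadj : ∀ {u v} → u ∈ map (place p) I → v ∈ map (place p) I → adj G u v ≡ false
    nonadj u∈ v∈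
      with i , _ , refl ← ∈-map⁻ (place p) u∈ | j , _ , refl ← ∈-map⁻ (place p) v∈ =
      multipartite-nonadjacent k {place p i} {place p j}
        (trans (part-place p i) (sym (part-place p j)))
    cont : ∀ {u} → u ∈ map (place p) I → u Subset.∈ F
    cont u∈ with i , i∈ , refl ← ∈-map⁻ (place p) u∈ =
      proj₂ (∈-filter⁻ (λ i → in? p i F) {xs = allFin k} i∈)

  -- Some vertex of the part `p` lies in at most half of `𝓕`: otherwise, by averaging, some `F`
  -- would contain at least half of that part, against `2 * a < k`. Containers avoiding the chosen
  -- vertex are dealt with; those containing it are left to the remaining parts.
  escaping-transversal : ∀ {a} → 2 * a < k → ∀ ps 𝓕 → (∀ {F} → F ∈ 𝓕 → α G F ≤ a) →
    length 𝓕 < 2 ^ length ps →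
    ∃[ us ] map (part k) us ≡ ps × (∀ {F} → F ∈ 𝓕 → Any (Subset._∉ F) us)
  escaping-transversal 2a<k []       []      _      _        = [] , refl , λ ()
  escaping-transversal 2a<k []       (_ ∷ _) _      (s≤s ())
  escaping-transversal {a} 2a<k (p ∷ ps) 𝓕 sparse few
    with any? (λ i → 2 * count (in? p i) 𝓕 ≤? length 𝓕) (allFin k)
  ... | no none = contradiction
    (averaging (in? p) 2 (allFin k) 𝓕
      (≤-<-trans z≤n (subst (2 * a <_) (sym (length-allFin k)) 2a<k))
      (λ i∈ → ≰⇒> (none ∘ lose i∈)))
    λ (F , F∈ , k≤) → <⇒≱ 2a<k (begin
      k                 ≡⟨ length-allFin k ⟨
      length (allFin k) ≤⟨ k≤ ⟩
      2 * count (λ i → in? p i F) (allFin k) ≤⟨ *-monoʳ-≤ 2 (≤-trans (part-count p F) (sparse F∈)) ⟩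
      2 * a ∎)
    where open ≤-Reasoning
  ... | yes some with i , _ , half ← find some
    with us , us-parts , escape ←
      escaping-transversal 2a<k ps (filter (in? p i) 𝓕)
        (sparse ∘ proj₁ ∘ ∈-filter⁻ (in? p i))
        (*-cancelˡ-< 2 _ _ (≤-<-trans half few)) =
    place p i ∷ us , cong₂ _∷_ (part-place p i) us-parts , escape′
    where
    escape′ : ∀ {F} → F ∈ 𝓕 → Any (Subset._∉ F) (place p i ∷ us)
    escape′ {F} F∈ with in? p i F
    ... | yes c∈ = there (escape (∈-filter⁺ (in? p i) F∈ c∈))
    ... | no  c∉ = here c∉

  -- One vertex per part spans a clique: nonadjacent vertices share a part, and `us` has only one in
  -- each.
  α-transversal : ∀ us → map (part k) us ≡ allFin k → α G (fromList us) ≤ 1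
  α-transversal us parts≡
    with S , S⊆ , ind , eq ← α-attained G (fromList us) =
    ≤-trans (≤-reflexive (trans (sym eq) (sym (length-elements S))))
      (at-most-one (elements-independent G S⊆ ind))
    where
    open IndependentList
    same : ∀ {m I u v} → IndependentList G (fromList us) m I → u ∈ I → v ∈ I → u ≡ v
    same {u = u} {v} I-ind u∈ v∈ = injective-on-unique (part k)
      (subst Unique (sym parts≡) (Unique.allFin⁺ k))
      (∈-fromList⁻ us (contained I-ind u∈)) (∈-fromList⁻ us (contained I-ind v∈))
      (decidable-stable (part k u Fin.≟ part k v) λ p≢ → contradiction
        (trans (sym (multipartite-adjacent k {u} {v} p≢)) (nonadjacent I-ind u∈ v∈)) λ ())
    at-most-one : ∀ {m I} → IndependentList G (fromList us) m I → length I ≤ 1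
    at-most-one {I = []}        _     = z≤n
    at-most-one {I = _ ∷ []}    _     = ≤-refl
    at-most-one {I = _ ∷ _ ∷ _} I-ind with (u≢v ∷ _) ∷ _ ← distinct I-ind =
      contradiction (same I-ind (here refl) (there (here refl))) u≢v

  -- The bound 1 makes `H` a set to be captured for every positive `b`.
  uncaptured : ∀ {a} 𝓕 → 2 * a < k → (∀ {F} → F ∈ 𝓕 → α G F ≤ a) → length 𝓕 < 2 ^ k →
    ∃[ H ] α G H ≤ 1 × (∀ {F} → F ∈ 𝓕 → ¬ (H Subset.⊆ F))
  uncaptured 𝓕 2a<k sparse few
    with us , us-parts , escape ← escaping-transversal 2a<k (allFin k) 𝓕 sparse
           (subst (λ j → length 𝓕 < 2 ^ j) (sym (length-allFin k)) few) =
    fromList us , α-transversal us us-parts ,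
    λ F∈ H⊆F → let u , u∈ , u∉F = find (escape F∈) in u∉F (H⊆F (∈-fromList⁺ u∈))

-- Polynomial bounds in the integer logarithm.

-- The argument `e` will be the integer part of `log n`. The base `suc e` is positive, so the degree
-- can be raised freely even at `e = 0`.
record PolyBounded (g : ℕ → ℕ) : Set where
  constructor polyBounded
  field
    coefficient degree : ℕ
    bound : ∀ e → g e ≤ coefficient * suc e ^ degree

open PolyBounded

poly-const : ∀ c → PolyBounded (λ _ → c)
poly-const c = polyBounded c 0 λ e → ≤-reflexive (sym (*-identityʳ c))

poly-suc : PolyBounded suc
poly-suc = polyBounded 1 1 λ e →
  ≤-reflexive (sym (trans (*-identityˡ _) (*-identityʳ (suc e))))

poly-mono : ∀ {g h} → (∀ e → g e ≤ h e) → PolyBounded h → PolyBounded g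
poly-mono g≤h (polyBounded A D h≤) = polyBounded A D λ e → ≤-trans (g≤h e) (h≤ e)

poly-+ : ∀ {g h} → PolyBounded g → PolyBounded h → PolyBounded (λ e → g e + h e)
poly-+ {g} {h} (polyBounded A D g≤) (polyBounded B E h≤) = polyBounded (A + B) (D + E) λ e → begin
  g e + h e                                      ≤⟨ +-mono-≤ (g≤ e) (h≤ e) ⟩
  A * suc e ^ D + B * suc e ^ E
    ≤⟨ +-mono-≤ (*-monoʳ-≤ A (^-monoʳ-≤ (suc e) (m≤m+n D E)))
                (*-monoʳ-≤ B (^-monoʳ-≤ (suc e) (m≤n+m E D))) ⟩
  A * suc e ^ (D + E) + B * suc e ^ (D + E)      ≡⟨ *-distribʳ-+ _ A B ⟨
  (A + B) * suc e ^ (D + E)                      ∎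
  where open ≤-Reasoning

poly-* : ∀ {g h} → PolyBounded g → PolyBounded h → PolyBounded (λ e → g e * h e)
poly-* {g} {h} (polyBounded A D g≤) (polyBounded B E h≤) = polyBounded (A * B) (D + E) λ e → begin
  g e * h e                            ≤⟨ *-mono-≤ (g≤ e) (h≤ e) ⟩
  A * suc e ^ D * (B * suc e ^ E)      ≡⟨ [m*n]*[o*p]≡[m*o]*[n*p] A (suc e ^ D) B (suc e ^ E) ⟩
  A * B * (suc e ^ D * suc e ^ E)      ≡⟨ cong (A * B *_) (^-distribˡ-+-* (suc e) D E) ⟨
  A * B * suc e ^ (D + E)              ∎
  where open ≤-Reasoning

poly-^ : ∀ {g} d → PolyBounded g → PolyBounded (λ e → g e ^ d)
poly-^ zero    _ = poly-const 1
poly-^ (suc d) p = poly-* p (poly-^ d p)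

n<2^n : ∀ n → n < 2 ^ n
n<2^n zero    = ≤-refl
n<2^n (suc n) = begin-strict
  suc n          <⟨ +-mono-≤-< (m^n>0 2 n) (n<2^n n) ⟩
  2 ^ n + 2 ^ n  ≡⟨ cong (2 ^ n +_) (+-identityʳ (2 ^ n)) ⟨
  2 ^ suc n      ∎
  where open ≤-Reasoning

-- The witness is `t = 2 * x` with `x = 2 * D + A`: then `2 ^ t` is at least `(1 + x)^2`, which
-- expands to more than `A + t * D`.
linear<exponential : ∀ A D → ∃[ t ] A + t * D < 2 ^ t
linear<exponential A D = x + x , (begin-strict
  A + (x + x) * D                                <⟨ n<1+n _ ⟩
  suc (A + (x + x) * D)                          ≤⟨ m≤m+n _ (A + D * 4 + A * x) ⟩
  suc (A + (x + x) * D) + (A + D * 4 + A * x)    ≡⟨ square A D ⟩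
  suc x * suc x                                  ≤⟨ *-mono-≤ (n<2^n x) (n<2^n x) ⟩
  2 ^ x * 2 ^ x                                  ≡⟨ ^-distribˡ-+-* 2 x x ⟨
  2 ^ (x + x)                                    ∎)
  where
  open ≤-Reasoning
  x = 2 * D + A
  square : ∀ A D → suc (A + (2 * D + A + (2 * D + A)) * D) + (A + D * 4 + A * (2 * D + A)) ≡
                   suc (2 * D + A) * suc (2 * D + A)
  square = solve-∀

-- Choosing `m + 1 = 2 ^ t` turns the polynomial into `A * 2 ^ (t * D)`, below `2 ^ (A + t * D)`,
-- and `linear<exponential` compares the exponents.
poly<exponential : ∀ {g} → PolyBounded g → ∃[ m ] g m < 2 ^ m
poly<exponential {g} (polyBounded A D g≤) with t , A+tD<2^t ← linear<exponential A D =
  m , (begin-strict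
    g m                    ≤⟨ g≤ m ⟩
    A * suc m ^ D          ≡⟨ cong (λ i → A * i ^ D) 1+m≡2^t ⟩
    A * (2 ^ t) ^ D        ≡⟨ cong (A *_) (^-*-assoc 2 t D) ⟩
    A * 2 ^ (t * D)        <⟨ *-monoˡ-< (2 ^ (t * D)) {{m^n≢0 2 (t * D)}} (n<2^n A) ⟩
    2 ^ A * 2 ^ (t * D)    ≡⟨ ^-distribˡ-+-* 2 A (t * D) ⟨
    2 ^ (A + t * D)        ≤⟨ ^-monoʳ-≤ 2 (s≤s⁻¹ (≤-trans A+tD<2^t (≤-reflexive (sym 1+m≡2^t)))) ⟩
    2 ^ m                  ∎)
  where
  open ≤-Reasoning
  m = pred (2 ^ t)
  1+m≡2^t : suc m ≡ 2 ^ t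
  1+m≡2^t = suc-pred (2 ^ t) {{m^n≢0 2 t}}

-- Integer logarithms and the two growth classes.

2^-cancel-≤ : ∀ {m n} → 2 ^ m ≤ 2 ^ n → m ≤ n
2^-cancel-≤ le = ≮⇒≥ λ n<m → ≤⇒≯ le (^-monoʳ-< 2 (s≤s (s≤s z≤n)) n<m)

log-exists : ∀ n → ∃[ e ] 2 ^ e ≤ suc n × suc n < 2 ^ suc e
log-exists zero    = 0 , s≤s z≤n , s≤s (s≤s z≤n)
log-exists (suc n) with e , lower , upper ← log-exists n with 2 ^ suc e ≤? suc (suc n)
... | no  ¬le = e , m≤n⇒m≤1+n lower , ≰⇒> ¬le
... | yes le  = suc e , le , ≤-<-trans upper (^-monoʳ-< 2 (s≤s (s≤s z≤n)) (n<1+n (suc e)))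

⌊log⌋ : ℕ⁺ → ℕ
⌊log⌋ n = proj₁ (log-exists (pred (value n)))

2^⌊log⌋≤ : ∀ n → 2 ^ ⌊log⌋ n ≤ value n
2^⌊log⌋≤ n@(v , [ v≢0 ]) = ≤-trans (proj₁ (proj₂ (log-exists (pred v))))
                                   (≤-reflexive (suc-pred v {{v≢0}}))

<2^1+⌊log⌋ : ∀ n → value n < 2 ^ suc (⌊log⌋ n)
<2^1+⌊log⌋ n@(v , [ v≢0 ]) = ≤-<-trans (≤-reflexive (sym (suc-pred v {{v≢0}})))
                                       (proj₂ (proj₂ (log-exists (pred v))))

-- Both sides are compared as exponents of 2, through `2 ^ ⌊log⌋ n ≤ value n`. This is how rational
-- upper bounds of the logarithm meet its integer part.
⌊log⌋*q≤p : ∀ n p q → log value n ≤ p / q → ⌊log⌋ n * q ≤ p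
⌊log⌋*q≤p n p q le = 2^-cancel-≤ (begin
  2 ^ (⌊log⌋ n * q)    ≡⟨ ^-*-assoc 2 (⌊log⌋ n) q ⟨
  (2 ^ ⌊log⌋ n) ^ q    ≤⟨ ^-monoˡ-≤ q (2^⌊log⌋≤ n) ⟩
  value n ^ q          ≤⟨ le ⟩
  2 ^ p                ∎)
  where open ≤-Reasoning

-- Since `suc e ≤ 2 * e`; this trades the base `suc e` of `PolyBounded` for `e`, which does not
-- exceed the real logarithm.
[1+e]^d≤2^d*e^d : ∀ {e} d → 0 < e → suc e ^ d ≤ 2 ^ d * e ^ d
[1+e]^d≤2^d*e^d {e} d 0<e = begin
  suc e ^ d        ≤⟨ ^-monoˡ-≤ d (+-mono-≤ 0<e (m≤m+n e 0)) ⟩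
  (2 * e) ^ d      ≡⟨ ^-*-distribʳ 2 e d ⟩
  2 ^ d * e ^ d    ∎
  where open ≤-Reasoning

positive : ∀ m → .{{NonZero m}} → ℕ⁺
positive m {{m≢0}} = m , [ m≢0 ]

polyLogarithmic : ∀ {g} → PolyBounded g → (a : ℕ⁺ → ℕ⁺) →
                  (∀ n → value (a n) ≤ g (⌊log⌋ n)) → PolyLogarithmic a
polyLogarithmic {g} (polyBounded A D g≤) a a≤ =
  -- The successors keep coefficient and degree positive; the power of 2 pays for replacing `suc e`
  -- by `2 * e`.
  positive (suc A * 2 ^ suc D) {{m*n≢0 (suc A) (2 ^ suc D) {{_}} {{m^n≢0 2 (suc D)}}}} ,
  positive (suc D) , bounded
  where
  open ≤-Reasoning
  bounded : ∀ n → 3 ≤ value n → value (a n) ≤ suc A * 2 ^ suc D ·log^ suc D [ value n ]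
  bounded n 3≤n p q log≤ = begin
    value (a n) * q ^ suc D
      ≤⟨ *-monoˡ-≤ (q ^ suc D) (≤-trans (a≤ n) (g≤ e)) ⟩
    A * suc e ^ D * q ^ suc D
      ≤⟨ *-monoˡ-≤ (q ^ suc D) (*-mono-≤ (n≤1+n A) (^-monoʳ-≤ (suc e) (n≤1+n D))) ⟩
    suc A * suc e ^ suc D * q ^ suc D
      ≤⟨ *-monoˡ-≤ (q ^ suc D) (*-monoʳ-≤ (suc A) ([1+e]^d≤2^d*e^d (suc D) 0<e)) ⟩
    suc A * (2 ^ suc D * e ^ suc D) * q ^ suc D
      ≡⟨ regroup (suc A) (2 ^ suc D) (e ^ suc D) (q ^ suc D) ⟩
    suc A * 2 ^ suc D * (e ^ suc D * q ^ suc D)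
      ≡⟨ cong (suc A * 2 ^ suc D *_) (^-*-distribʳ e q (suc D)) ⟨
    suc A * 2 ^ suc D * (e * q) ^ suc D
      ≤⟨ *-monoʳ-≤ (suc A * 2 ^ suc D) (^-monoˡ-≤ (suc D) (⌊log⌋*q≤p n p q log≤)) ⟩
    suc A * 2 ^ suc D * p ^ suc D ∎
    where
    e = ⌊log⌋ n
    0<e : 0 < e
    0<e = s≤s⁻¹ (≰⇒> {suc e} {1} λ 1+e≤1 → <⇒≱ (≤-<-trans 3≤n (<2^1+⌊log⌋ n))
            (≤-trans (^-monoʳ-≤ 2 1+e≤1) (n≤1+n 2)))
    regroup : ∀ i j k l → i * (j * k) * l ≡ i * j * (k * l)
    regroup = solve-∀

-- Here `e = 0` must be allowed. A large `e` absorbs the coefficient into an extra factor `e`; for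
-- the remaining `e` the exponent is at most a constant `C`, which becomes the factor `2 ^ C`. The
-- rest is `2 ^ e ≤ n`.
quasiPolynomial : ∀ {g} → PolyBounded g → (f : ℕ⁺ → ℕ⁺) →
                  (∀ n → value (f n) ≤ 2 ^ g (⌊log⌋ n)) → QuasiPolynomial f
quasiPolynomial {g} (polyBounded A D g≤) f f≤ =
  positive (2 ^ C) {{m^n≢0 2 C}} , positive (suc D) , bounded
  where
  open ≤-Reasoning
  -- `B` is the coefficient after `suc e` is replaced by `2 * e`; `C` is the polynomial bound at
  -- `e = B`.
  B = A * 2 ^ D
  C = A * suc B ^ D
  split : ∀ e → g e ≤ C + e * e ^ suc D
  split e with e ≤? B
  ... | yes e≤B = begin
    g e                    ≤⟨ g≤ e ⟩
    A * suc e ^ D          ≤⟨ *-monoʳ-≤ A (^-monoˡ-≤ D (s≤s e≤B)) ⟩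
    C                      ≤⟨ m≤m+n C _ ⟩
    C + e * e ^ suc D      ∎
  ... | no e≰B = begin
    g e                    ≤⟨ g≤ e ⟩
    A * suc e ^ D          ≤⟨ *-monoʳ-≤ A ([1+e]^d≤2^d*e^d D 0<e) ⟩
    A * (2 ^ D * e ^ D)    ≡⟨ *-assoc A (2 ^ D) (e ^ D) ⟨
    B * e ^ D              ≤⟨ *-mono-≤ B≤e (m≤n*m (e ^ D) e {{>-nonZero 0<e}}) ⟩
    e * e ^ suc D          ≤⟨ m≤n+m _ C ⟩
    C + e * e ^ suc D      ∎
    where
    B≤e = <⇒≤ (≰⇒> e≰B)
    0<e : 0 < e
    0<e = ≤-<-trans z≤n (≰⇒> e≰B)
  bounded : ∀ n → value (f n) ≤ 2 ^ C · value n ^log^ suc D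
  bounded n p q log≤ = begin
    value (f n) ^ Q
      ≤⟨ ^-monoˡ-≤ Q (≤-trans (f≤ n) (^-monoʳ-≤ 2 (split e))) ⟩
    (2 ^ (C + e * e ^ suc D)) ^ Q
      ≡⟨ cong (_^ Q) (^-distribˡ-+-* 2 C (e * e ^ suc D)) ⟩
    (2 ^ C * 2 ^ (e * e ^ suc D)) ^ Q
      ≡⟨ ^-*-distribʳ (2 ^ C) _ Q ⟩
    (2 ^ C) ^ Q * (2 ^ (e * e ^ suc D)) ^ Q
      ≤⟨ *-monoʳ-≤ ((2 ^ C) ^ Q) tail ⟩
    (2 ^ C) ^ Q * value n ^ (p ^ suc D) ∎
    where
    e = ⌊log⌋ n
    Q = q ^ suc D
    tail : (2 ^ (e * e ^ suc D)) ^ Q ≤ value n ^ (p ^ suc D)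
    tail = begin
      (2 ^ (e * e ^ suc D)) ^ Q      ≡⟨ ^-*-assoc 2 (e * e ^ suc D) Q ⟩
      2 ^ (e * e ^ suc D * Q)        ≡⟨ cong (2 ^_) (*-assoc e (e ^ suc D) Q) ⟩
      2 ^ (e * (e ^ suc D * Q))      ≡⟨ cong (λ i → 2 ^ (e * i)) (^-*-distribʳ e q (suc D)) ⟨
      2 ^ (e * (e * q) ^ suc D)      ≤⟨ ^-monoʳ-≤ 2 (*-monoʳ-≤ e (^-monoˡ-≤ (suc D) (⌊log⌋*q≤p n p q log≤))) ⟩
      2 ^ (e * p ^ suc D)            ≡⟨ ^-*-assoc 2 e (p ^ suc D) ⟨
      (2 ^ e) ^ (p ^ suc D)          ≤⟨ ^-monoˡ-≤ (p ^ suc D) (2^⌊log⌋≤ n) ⟩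
      value n ^ (p ^ suc D)          ∎

value-positive : ∀ (n : ℕ⁺) → 1 ≤ value n
value-positive (v , [ v≢0 ]) = >-nonZero⁻¹ v {{v≢0}}

-- For `n ≥ 3` the hypothesis is used with the rational `suc (⌊log⌋ n) / 1`. It says nothing about
-- `n = 1` and `n = 2`, so the values there are added to the coefficient.
polyLogarithmic-≤ : ∀ b → PolyLogarithmic b →
  ∃[ c ] ∃[ d ] NonZero c × (∀ n → value (b n) ≤ c * suc (⌊log⌋ n) ^ d)
polyLogarithmic-≤ b ((c , _) , (d , _) , b≤) =
  c + (b₁ + b₂) , d ,
  >-nonZero (≤-trans (value-positive (b (positive 1))) (≤-trans (m≤m+n b₁ b₂) (m≤n+m _ c))) ,
  bounded
  where
  b₁ = value (b (positive 1))
  b₂ = value (b (positive 2))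
  bounded : ∀ n → value (b n) ≤ (c + (b₁ + b₂)) * suc (⌊log⌋ n) ^ d
  bounded (zero , [ 0≢0 ]) = contradiction refl (≢-nonZero⁻¹ 0 {{0≢0}})
  bounded n@(suc zero , _) = ≤-trans (≤-trans (m≤m+n b₁ b₂) (m≤n+m _ c))
    (m≤m*n _ (suc (⌊log⌋ n) ^ d) {{m^n≢0 (suc (⌊log⌋ n)) d}})
  bounded n@(suc (suc zero) , _) = ≤-trans (≤-trans (m≤n+m b₂ b₁) (m≤n+m _ c))
    (m≤m*n _ (suc (⌊log⌋ n) ^ d) {{m^n≢0 (suc (⌊log⌋ n)) d}})
  bounded n@(suc (suc (suc v)) , _) = begin
    value (b n)                  ≡⟨ *-identityʳ _ ⟨
    value (b n) * 1              ≡⟨ cong (value (b n) *_) (^-zeroˡ d) ⟨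
    value (b n) * 1 ^ d          ≤⟨ b≤ n (s≤s (s≤s (s≤s z≤n))) (suc e) 1
                                    (≤-trans (≤-reflexive (*-identityʳ _)) (<⇒≤ (<2^1+⌊log⌋ n))) ⟩
    c * suc e ^ d                ≤⟨ *-monoˡ-≤ (suc e ^ d) (m≤m+n c (b₁ + b₂)) ⟩
    (c + (b₁ + b₂)) * suc e ^ d  ∎
    where
    open ≤-Reasoning
    e = ⌊log⌋ n

-- Polynomial growth of the container bounds.

module _ {b : ℕ → ℕ} (b-poly : PolyBounded b) (k : ℕ) where

  private
    s-poly : PolyBounded (λ e → b e * k)
    s-poly = poly-* b-poly (poly-const k)

    rounds-poly : PolyBounded (λ e → suc (suc e * (b e * k)))
    rounds-poly = poly-+ (poly-const 1) (poly-* poly-suc s-poly)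

    high-poly : ∀ {g} → PolyBounded g →
      PolyBounded (λ e → 2 * b e * suc e * (suc (b e * k) ^ k * g e))
    high-poly g-poly = poly-* (poly-* (poly-* (poly-const 2) b-poly) poly-suc)
      (poly-* (poly-^ k (poly-+ (poly-const 1) s-poly)) g-poly)

  sparsity-poly : ∀ r → PolyBounded (λ e → sparsity (b e) k (suc e) r)
  sparsity-poly zero    = poly-const 0
  sparsity-poly (suc r) =
    poly-+ s-poly (poly-* rounds-poly (poly-+ (high-poly (sparsity-poly r)) b-poly))

  exponent-poly : ∀ r → PolyBounded (λ e → exponent (b e) k (suc e) r)
  exponent-poly zero    = poly-const 0
  exponent-poly (suc r) =
    poly-* rounds-poly (poly-+ (high-poly (exponent-poly r)) (poly-* poly-suc b-poly))

-- The size of the excluded graph.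

poly-double : PolyBounded (λ m → m + m)
poly-double = poly-mono (λ m → +-mono-≤ (n≤1+n m) (n≤1+n m)) (poly-+ poly-suc poly-suc)

-- A single inequality gives both smallness conditions for `k = 2 ^ m`: its first summand concerns
-- the sparsity of the containers, the second the logarithm of their number.
module _ (c d c′ d′ m : ℕ) .{{_ : NonZero c′}}
  (large : 2 * (c * (m + m) ^ d) + (c′ + (m + m) * (m + m) ^ d′) < 2 ^ m) where

  open ≤-Reasoning

  private
    k : ℕ
    k = 2 ^ m

    log≤ : log (k * k) ≤ m + m / 1
    log≤ = ≤-reflexive (trans (*-identityʳ (k * k)) (sym (^-distribˡ-+-* 2 m m)))

  -- It makes `k * k` at least 4, where the poly-logarithmic bound is in force.
  1<2^m : 1 < k
  1<2^m = begin-strict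
    1                              ≤⟨ >-nonZero⁻¹ c′ ⟩
    c′                             ≤⟨ m≤m+n c′ _ ⟩
    c′ + (m + m) * (m + m) ^ d′    ≤⟨ m≤n+m _ (2 * (c * (m + m) ^ d)) ⟩
    2 * (c * (m + m) ^ d) + (c′ + (m + m) * (m + m) ^ d′)  <⟨ large ⟩
    k                              ∎

  polyLog-small : ∀ {x} → x ≤ c ·log^ d [ k * k ] → 2 * x < k
  polyLog-small {x} x≤ = begin-strict
    2 * x                    ≡⟨ cong (2 *_) (*-identityʳ x) ⟨
    2 * (x * 1)              ≡⟨ cong (λ i → 2 * (x * i)) (^-zeroˡ d) ⟨
    2 * (x * 1 ^ d)          ≤⟨ *-monoʳ-≤ 2 (x≤ (m + m) 1 log≤) ⟩
    2 * (c * (m + m) ^ d)    ≤⟨ m≤m+n _ (c′ + (m + m) * (m + m) ^ d′) ⟩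
    2 * (c * (m + m) ^ d) + (c′ + (m + m) * (m + m) ^ d′)  <⟨ large ⟩
    k                        ∎

  -- As `log (k * k) = m + m`, the quasi-polynomial bound is `c′ * 2 ^ M`, and `c′ < 2 ^ c′` moves
  -- the coefficient into the exponent.
  quasiPoly-small : ∀ {x} → x ≤ c′ · k * k ^log^ d′ → x < 2 ^ k
  quasiPoly-small {x} x≤ = begin-strict
    x                                      ≡⟨ ^1^ x ⟨
    x ^ (1 ^ d′)                           ≤⟨ x≤ (m + m) 1 log≤ ⟩
    c′ ^ (1 ^ d′) * (k * k) ^ ((m + m) ^ d′)
      ≡⟨ cong₂ (λ i j → i * j ^ ((m + m) ^ d′)) (^1^ c′) (sym (^-distribˡ-+-* 2 m m)) ⟩
    c′ * (2 ^ (m + m)) ^ ((m + m) ^ d′)    ≡⟨ cong (c′ *_) (^-*-assoc 2 (m + m) _) ⟩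
    c′ * 2 ^ M                             <⟨ *-monoˡ-< (2 ^ M) {{m^n≢0 2 M}} (n<2^n c′) ⟩
    2 ^ c′ * 2 ^ M                         ≡⟨ ^-distribˡ-+-* 2 c′ M ⟨
    2 ^ (c′ + M)
      ≤⟨ ^-monoʳ-≤ 2 (≤-trans (m≤n+m (c′ + M) (2 * (c * (m + m) ^ d))) (<⇒≤ large)) ⟩
    2 ^ k                                  ∎
    where
    M = (m + m) * (m + m) ^ d′
    ^1^ : ∀ i → i ^ (1 ^ d′) ≡ i
    ^1^ i = trans (cong (i ^_) (^-zeroˡ d′)) (*-identityʳ i)

-- The two implications.

QuasiPolynomialContainers : ∀ {ℓ} → GraphClass ℓ → (ℕ⁺ → ℕ⁺) → Set ℓ
QuasiPolynomialContainers C b =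
  Σ[ a ∈ (ℕ⁺ → ℕ⁺) ] Σ[ f ∈ (ℕ⁺ → ℕ⁺) ]
    PolyLogarithmic a × QuasiPolynomial f ×
    (∀ (n : ℕ⁺) (G : Graph (value n)) → C G →
      ∃[ 𝓕 ] IsContainerFamily G (b n) (a n) 𝓕 × length 𝓕 ≤ value (f n))

module _ {ℓ} (C : GraphClass ℓ) (b : ℕ⁺ → ℕ⁺) where

  -- Heredity excludes `k` nested parts in every graph of the class, so `containers-of-free` applies
  -- to the full vertex set with `r = k`.
  containers-of-excluded : Hereditary C → PolyLogarithmic b →
    ∀ k → .{{NonZero k}} → ¬ C (multipartite k) → QuasiPolynomialContainers C b
  containers-of-excluded hereditary b-polylog k excluded
    with c , d , c≢0 , b≤ ← polyLogarithmic-≤ b b-polylog =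
    a , f ,
    polyLogarithmic (poly-+ (poly-const 1) (sparsity-poly B-poly k k)) a (λ _ → ≤-refl) ,
    quasiPolynomial (exponent-poly B-poly k k) f (λ _ → ≤-refl) ,
    containers
    where
    -- `b n` is replaced by an upper bound polynomial in the integer logarithm; containers for the
    -- larger bound capture all the sets in question.
    B : ℕ → ℕ
    B e = c * suc e ^ d
    B-poly : PolyBounded B
    B-poly = poly-* (poly-const c) (poly-^ d poly-suc)
    instance
      B-nonZero : ∀ {e} → NonZero (B e)
      B-nonZero {e} = m*n≢0 c (suc e ^ d) {{c≢0}} {{m^n≢0 (suc e) d}}
    a f : ℕ⁺ → ℕ⁺
    a n = positive (suc (sparsity (B (⌊log⌋ n)) k (suc (⌊log⌋ n)) k))
    f n = let m = exponent (B (⌊log⌋ n)) k (suc (⌊log⌋ n)) k in positive (2 ^ m) {{m^n≢0 2 m}}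
    containers : ∀ n (G : Graph (value n)) → C G →
      ∃[ 𝓕 ] IsContainerFamily G (b n) (a n) 𝓕 × length 𝓕 ≤ value (f n)
    containers n G G∈C = family ,
      ( (λ F F∈ → ≤-trans (sparse F∈) (n≤1+n _))
      , λ H αH → let F , F∈ , sub = capture H (≤-trans αH (b≤ n)) in
                 F , F∈ , λ x∈ → sub x∈ Subset.∈⊤) ,
      few
      where
      open HasContainers
        (containers-of-free G (B (⌊log⌋ n)) k (suc (⌊log⌋ n)) (<2^1+⌊log⌋ n) k Subset.⊤
          λ M → excluded (hereditary (parts-embedding k (parts G k M)) G∈C))

  -- With k = 2 ^ m, the graph has n = k ^ 2 vertices and log n = 2 m exactly.
  excluded-of-large : ∀ {a f : ℕ⁺ → ℕ⁺} c d c′ d′ m → .{{_ : NonZero c′}} →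
    2 * (c * (m + m) ^ d) + (c′ + (m + m) * (m + m) ^ d′) < 2 ^ m →
    (∀ n → 3 ≤ value n → value (a n) ≤ c ·log^ d [ value n ]) →
    (∀ n → value (f n) ≤ c′ · value n ^log^ d′) →
    (∀ (n : ℕ⁺) (G : Graph (value n)) → C G →
      ∃[ 𝓕 ] IsContainerFamily G (b n) (a n) 𝓕 × length 𝓕 ≤ value (f n)) →
    ¬ C (multipartite (2 ^ m))
  excluded-of-large {a} {f} c d c′ d′ m large a≤ f≤ containers member =
    let 𝓕 , (sparse , capture) , few = containers n (multipartite k) member
        H , αH , escapes = uncaptured k 𝓕 2a<k (λ {F} → sparse F) (≤-<-trans few f<2^k)
        F , F∈ , H⊆F = capture H (≤-trans αH (value-positive (b n)))
    in escapes F∈ H⊆F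
    where
    k = 2 ^ m
    n = positive (k * k) {{m*n≢0 k k {{m^n≢0 2 m}} {{m^n≢0 2 m}}}}
    1<k : 1 < k
    1<k = 1<2^m c d c′ d′ m large
    2a<k : 2 * value (a n) < k
    2a<k = polyLog-small c d c′ d′ m large {value (a n)}
      (a≤ n (≤-trans (n≤1+n 3) (*-mono-≤ 1<k 1<k)))
    f<2^k : value (f n) < 2 ^ k
    f<2^k = quasiPoly-small c d c′ d′ m large {value (f n)} (f≤ n)

  excluded-of-containers : QuasiPolynomialContainers C b →
    Σ[ k ∈ ℕ⁺ ] ¬ C (multipartite (value k))
  excluded-of-containers
    (a , f , ((c , _) , (d , _) , a≤) , ((c′ , [ c′≢0 ]) , (d′ , _) , f≤) , containers) =
    positive (2 ^ m) {{m^n≢0 2 m}} ,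
    excluded-of-large {a} {f} c d c′ d′ m {{c′≢0}} (proj₂ threshold) a≤ f≤ containers
    where
    threshold : ∃[ m ] 2 * (c * (m + m) ^ d) + (c′ + (m + m) * (m + m) ^ d′) < 2 ^ m
    -- Both requirements are polynomial in `m`, so `2 ^ m` exceeds their sum for some `m`.
    threshold = poly<exponential
      (poly-+ (poly-* (poly-const 2) (poly-* (poly-const c) (poly-^ d poly-double)))
              (poly-+ (poly-const c′) (poly-* poly-double (poly-^ d′ poly-double))))
    m = proj₁ threshold

theorem1p3 : ∀ {ℓ} (C : GraphClass ℓ) (b : ℕ⁺ → ℕ⁺) →
    Hereditary C → PolyLogarithmic b →
    (Σ[ a ∈ (ℕ⁺ → ℕ⁺) ] Σ[ f ∈ (ℕ⁺ → ℕ⁺) ]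
    PolyLogarithmic a × QuasiPolynomial f ×
    (∀ (n : ℕ⁺) (G : Graph (value n)) → C G →
    ∃[ 𝓕 ] IsContainerFamily G (b n) (a n) 𝓕 × length 𝓕 ≤ value (f n)))
    ⇔
    (Σ[ k ∈ ℕ⁺ ] ¬ C (complement (copies (value k) (complete (value k)))))
theorem1p3 C b hereditary b-polylog = mk⇔ (excluded-of-containers C b)
  λ { ((k , [ k≢0 ]) , excluded) →
        containers-of-excluded C b hereditary b-polylog k {{k≢0}} excluded }
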